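{- For all $n\geq1$, \[ G_n(p,q,x)=\sum_{u\in U_n}pqx\,\frac{(px)^{\mathrm{ret}_1^-(u)}(qx)^{\mathrm{ret}_1^+(u)}}{(1-px)^{u(1)}(1-qx)^{n+1-u(1)}}=\frac{pqx\,U_n(px,qx)}{(1-qx)^{n+1}}. \]
   Context: For $n\ge1$, let $\mathcal{A}_n(m)$ be the set of maps $f:[n]\to\{1,\dots,m\}$ with $f(j)\le f(j+1)$ for odd $j\in[n-1]$ and $f(j)\ge f(j+1)$ for even $j\in[n-1]$; $\Omega_n(p,q;m)=\sum_{f\in\mathcal{A}_n(m)}p^{f(1)}q^{m+1-f(1)}$ and $G_n(p,q,x)=\sum_{m\ge1}\Omega_n(p,q;m)x^m$. $U_n$ is the set of $u\in S_n$ with $u(1)<u(2)>u(3)<\cdots$. For $u\in S_n$, $\mathrm{Ret}_1(u)=\{i\in[n-1]:u^{ -1}(i)>u^{ -1}(i+1)+1\}$, $\mathrm{ret}_1^-(u)=|\mathrm{Ret}_1(u)\cap\{1,\dots,u(1)\}|$, $\mathrm{ret}_1^+(u)=|\mathrm{Ret}_1(u)\cap\{u(1)+1,\dots,n-1\}|$. $U_n(s,t)=\sum_{u\in U_n}s^{\mathrm{ret}_1^-(u)}t^{\mathrm{ret}_1^+(u)}\left(\frac{1-t}{1-s}\right)^{u(1)}$. -}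

module Defs where

open import Data.Nat.Base using (ℕ; zero; suc; _∸_; _≤ᵇ_; _<ᵇ_; _≡ᵇ_)
open import Data.Bool.Base using (Bool; true; false; if_then_else_; _∧_)
open import Data.List.Base using (List; []; _∷_; [_]; map; concatMap; filterᵇ; length; upTo; foldr)
open import Algebra.Bundles using (CommutativeRing)
import Data.Nat.Base as ℕ

odd : ℕ → Bool
odd zero = false
odd (suc j) = if odd j then false else true

range1 : ℕ → List ℕ
range1 m = map suc (upTo m)

-- all maps [n] → {1..m}, a map f represented as the list f(1),...,f(n)
allMaps : ℕ → ℕ → List (List ℕ)
allMaps zero m = [ [] ]
allMaps (suc n) m = concatMap (λ v → map (λ a → a ∷ v) (range1 m)) (allMaps n m)

-- altF j (f(j) ∷ f(j+1) ∷ …): f(i) ≤ f(i+1) for odd i, f(i) ≥ f(i+1) for even i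
altF : ℕ → List ℕ → Bool
altF j (a ∷ b ∷ rest) = (if odd j then a ≤ᵇ b else b ≤ᵇ a) ∧ altF (suc j) (b ∷ rest)
altF j _ = true

𝒜 : ℕ → ℕ → List (List ℕ)
𝒜 n m = filterᵇ (altF 1) (allMaps n m)

-- first entry (f(1), resp. u(1)); 0 on the empty list (never used for n ≥ 1)
hd : List ℕ → ℕ
hd [] = 0
hd (a ∷ _) = a

-- all permutations of [n], u represented as the list u(1),...,u(n)
insertAll : ℕ → List ℕ → List (List ℕ)
insertAll x [] = [ x ∷ [] ]
insertAll x (y ∷ ys) = (x ∷ y ∷ ys) ∷ map (λ l → y ∷ l) (insertAll x ys)

perms : ℕ → List (List ℕ)
perms zero = [ [] ]
perms (suc n) = concatMap (insertAll (suc n)) (perms n)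

altU : ℕ → List ℕ → Bool
altU j (a ∷ b ∷ rest) = (if odd j then a <ᵇ b else b <ᵇ a) ∧ altU (suc j) (b ∷ rest)
altU j _ = true

Uset : ℕ → List (List ℕ)
Uset n = filterᵇ (altU 1) (perms n)

pos : List ℕ → ℕ → ℕ
pos [] i = 0
pos (y ∷ ys) i = if y ≡ᵇ i then 1 else suc (pos ys i)

inRet : List ℕ → ℕ → Bool
inRet u i = suc (pos u (suc i)) <ᵇ pos u i

retMinus : ℕ → List ℕ → ℕ
retMinus n u = length (filterᵇ (λ i → (i ≤ᵇ hd u) ∧ inRet u i) (range1 (n ∸ 1)))

retPlus : ℕ → List ℕ → ℕ
retPlus n u = length (filterᵇ (λ i → (hd u <ᵇ i) ∧ inRet u i) (range1 (n ∸ 1)))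

-- Formal power series in x over a commutative ring R
-- (p, q are arbitrary elements of R; taking R = ℤ[p,q] gives the paper's setting)

module Series {c ℓ} (R : CommutativeRing c ℓ) where
  open CommutativeRing R

  PS : Set c
  PS = ℕ → Carrier

  _≈ₛ_ : PS → PS → Set ℓ
  f ≈ₛ g = ∀ k → f k ≈ g k

  pow : Carrier → ℕ → Carrier
  pow a zero = 1#
  pow a (suc k) = a * pow a k

  sumL : List Carrier → Carrier
  sumL = foldr _+_ 0#

  sumBelow : ℕ → (ℕ → Carrier) → Carrier
  sumBelow zero h = 0#
  sumBelow (suc n) h = sumBelow n h + h n

  cst : Carrier → PS
  cst a zero = a
  cst a (suc k) = 0#

  𝟙 : PS
  𝟙 = cst 1#

  X : PS
  X zero = 0#
  X (suc zero) = 1#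
  X (suc (suc k)) = 0#

  _⊕_ : PS → PS → PS
  (f ⊕ g) k = f k + g k

  _⊖_ : PS → PS → PS
  (f ⊖ g) k = f k - g k

  _⊛_ : PS → PS → PS
  (f ⊛ g) k = sumBelow (suc k) (λ i → f i * g (k ∸ i))

  infixl 6 _⊕_ _⊖_
  infixl 7 _⊛_

  _^ₛ_ : PS → ℕ → PS
  f ^ₛ zero = 𝟙
  f ^ₛ suc k = f ⊛ (f ^ₛ k)

  sumₛ : List PS → PS
  sumₛ = foldr _⊕_ (cst 0#)

  -- 1/(1 - a x) = Σ_k a^k x^k, the inverse of 𝟙 ⊖ cst a ⊛ X in R[[x]]
  inv1m : Carrier → PS
  inv1m a k = pow a k

  Ω : ℕ → Carrier → Carrier → ℕ → Carrier
  Ω n p q m = sumL (map (λ f → pow p (hd f) * pow q (m ℕ.+ 1 ∸ hd f)) (𝒜 n m))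

  G : ℕ → Carrier → Carrier → PS
  G n p q zero = 0#
  G n p q (suc m) = Ω n p q (suc m)

  middle : ℕ → Carrier → Carrier → PS
  middle n p q = sumₛ (map (λ u →
      cst (p * q) ⊛ X ⊛ ((cst p ⊛ X) ^ₛ retMinus n u) ⊛ ((cst q ⊛ X) ^ₛ retPlus n u)
        ⊛ (inv1m p ^ₛ hd u) ⊛ (inv1m q ^ₛ (n ℕ.+ 1 ∸ hd u)))
    (Uset n))

  -- U_n(s,t) evaluated at s = px, t = qx:
  -- Σ_{u∈U_n} s^{ret⁻} t^{ret⁺} ((1-t)/(1-s))^{u(1)}
  UnAt : ℕ → Carrier → Carrier → PS
  UnAt n p q = sumₛ (map (λ u →
      ((cst p ⊛ X) ^ₛ retMinus n u) ⊛ ((cst q ⊛ X) ^ₛ retPlus n u)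
        ⊛ (((𝟙 ⊖ cst q ⊛ X) ⊛ inv1m p) ^ₛ hd u))
    (Uset n))

  rhs : ℕ → Carrier → Carrier → PS
  rhs n p q = cst (p * q) ⊛ X ⊛ UnAt n p q ⊛ (inv1m q ^ₛ (n ℕ.+ 1))

{-# OPTIONS --safe #-}
module Submission where

-- Send f ∈ 𝒜_n(m) to the permutation u that ranks the positions j by (f(j), ω(j)), where the
-- tie-breaking order ω is 1 < 3 < 2 < 5 < 4 < ⋯.  Since ω is a linear extension of the zigzag poset,
-- f is weakly alternating iff u is alternating, and for alternating u a descent of ω along
-- u⁻¹(1), u⁻¹(2), … at i means exactly u⁻¹(i) > u⁻¹(i+1) + 1.  Hence the f with a given u are the
-- a ∘ u for sequences 1 ≤ a₁ ≤ ⋯ ≤ aₙ ≤ m with aᵢ < aᵢ₊₁ at each i ∈ Ret₁(u).  Such a sequence is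
-- determined by its n + 1 gaps; since f(1) = a_{u(1)}, the u(1) gaps up to a_{u(1)} carry weight px
-- per unit and the remaining n + 1 − u(1) carry qx, so each gap contributes a geometric series,
-- multiplied by px or qx when the gap is forced to be positive.

open import Defs
open import Algebra.Bundles using (CommutativeMonoid; CommutativeRing)
open import Data.Bool.Base using (Bool; true; false; _∧_; if_then_else_)
open import Data.Bool.Properties using (T-≡; ∧-zeroʳ)
open import Data.List.Base using (List; []; _∷_; [_]; map; _++_; concatMap; length; filterᵇ)
open import Data.List.Membership.Propositional using (_∈_)
open import Data.List.Properties using (length-map)
open import Data.List.Relation.Binary.Permutation.Propositional as ↭ using (_↭_)
open import Data.List.Relation.Unary.Any using (here; there)
open import Data.Nat.Base as ℕ using (ℕ; zero; suc; _∸_; _<_; _≤_; _<ᵇ_; _≤ᵇ_; s≤s)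
import Data.Nat.Properties as ℕ
open import Data.Product.Base using (∃; _×_; _,_; proj₁; proj₂)
open import Data.Sum.Base using (_⊎_; inj₁; inj₂)
open import Function.Bundles using (Equivalence)
import Relation.Binary.PropositionalEquality as ≡
open ≡ using (_≡_)
import Relation.Binary.Reasoning.Setoid as SetoidReasoning
open import Relation.Nullary.Negation using (contradiction)

-- Where the `+ 1` in Ret₁ comes from: the only pairs of positions that ω puts in reverse are (y, y
-- + 1) with y even, and these are exactly the neighbours at which an alternating u falls. So if i +
-- 1 and i occupy neighbouring positions, in either order, ω rises from the position of i to that of
-- i + 1. Only a backward jump of two or more is a descent of ω. Why the weights split cleanly at
-- u(1): gap i lies between aᵢ and aᵢ₊₁, so gap u(1) already carries qx, although ret₁⁻ counts the
-- index i = u(1). The conventions agree because u(1) stands at position 1 and therefore never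
-- belongs to Ret₁(u). Where pqx comes from: the gaps add up to m - 1 only. One factor p belongs to
-- the starting value 1, one factor q to the excess of m + 1 - f(1) over the m - f(1) units above
-- f(1), and one x to the excess of m over m - 1.

iota : ℕ → ℕ → List ℕ
iota o zero = []
iota o (suc l) = o ∷ iota (suc o) l

at : List ℕ → ℕ → ℕ
at [] _ = 0
at (x ∷ xs) zero = x
at (x ∷ xs) (suc i) = at xs i

-- seqs ds c r: sequences with entries in {c, …, c + r} whose successive gaps, starting from c, are
-- positive where ds says true and nonnegative elsewhere.
mutual
  seqs : List Bool → ℕ → ℕ → List (List ℕ)
  seqs [] c r = [ [] ]
  seqs (false ∷ ds) c r = steps ds c r
  seqs (true ∷ ds) c zero = []
  seqs (true ∷ ds) c (suc r) = steps ds (suc c) r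

  -- A gap grows by one unit per recursive call, so that the enumeration follows the coefficient
  -- recurrence of a product with a geometric series (`inv1m-suc`).
  steps : List Bool → ℕ → ℕ → List (List ℕ)
  steps ds c zero = map (c ∷_) (seqs ds c zero)
  steps ds c (suc r) = map (c ∷_) (seqs ds c (suc r)) ++ steps ds (suc c) r

tally : Bool → ℕ
tally d = if d then 1 else 0

length-filterᵇ-∷ : {A : Set} (P : A → Bool) (x : A) (xs : List A) →
  length (filterᵇ P (x ∷ xs)) ≡ tally (P x) ℕ.+ length (filterᵇ P xs)
length-filterᵇ-∷ P x xs with P x
... | true = ≡.refl
... | false = ≡.refl

<ᵇ-true : ∀ {m n} → m < n → (m <ᵇ n) ≡ true
<ᵇ-true m<n = Equivalence.to T-≡ (ℕ.<⇒<ᵇ m<n)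

<ᵇ-false : ∀ {m n} → n ≤ m → (m <ᵇ n) ≡ false
<ᵇ-false {m} {n} n≤m with m <ᵇ n in eq
... | false = ≡.refl
... | true = contradiction (ℕ.<ᵇ⇒< m n (Equivalence.from T-≡ eq)) (ℕ.≤⇒≯ n≤m)

≤ᵇ-true : ∀ {m n} → m ≤ n → (m ≤ᵇ n) ≡ true
≤ᵇ-true m≤n = Equivalence.to T-≡ (ℕ.≤⇒≤ᵇ m≤n)

≤ᵇ-false : ∀ {m n} → n < m → (m ≤ᵇ n) ≡ false
≤ᵇ-false {suc m} (s≤s n≤m) = <ᵇ-false n≤m

-- Counting marked indices up to `K` and beyond it

module _ (K : ℕ) (D : ℕ → Bool) where

  upto after : List ℕ → ℕ
  upto is = length (filterᵇ (λ i → (i ≤ᵇ K) ∧ D i) is)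
  after is = length (filterᵇ (λ i → (K <ᵇ i) ∧ D i) is)

  upto-early : ∀ o is → o < K → upto (o ∷ is) ≡ tally (D o) ℕ.+ upto is
  upto-early o is o<K = ≡.trans (length-filterᵇ-∷ _ o is)
    (≡.cong (λ b → tally (b ∧ D o) ℕ.+ upto is) (≤ᵇ-true (ℕ.<⇒≤ o<K)))

  after-early : ∀ o is → o < K → after (o ∷ is) ≡ after is
  after-early o is o<K = ≡.trans (length-filterᵇ-∷ _ o is)
    (≡.cong (λ b → tally (b ∧ D o) ℕ.+ after is) (<ᵇ-false (ℕ.<⇒≤ o<K)))

  -- Gap `K` follows the entry with index `K` and so belongs to the late gaps, while `upto` counts
  -- index `K` as early. `DK` reconciles the two.
  module _ (DK : D K ≡ false) where

    after-late : ∀ o is → K ≤ o → after (o ∷ is) ≡ tally (D o) ℕ.+ after is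
    after-late o is K≤o = ≡.trans (length-filterᵇ-∷ _ o is)
      (≡.cong (λ b → tally b ℕ.+ after is) (go (ℕ.m≤n⇒m<n∨m≡n K≤o)))
      where
      go : K < o ⊎ K ≡ o → (K <ᵇ o) ∧ D o ≡ D o
      go (inj₁ K<o) = ≡.cong (_∧ D o) (<ᵇ-true K<o)
      go (inj₂ ≡.refl) rewrite DK = ∧-zeroʳ (K <ᵇ o)

    upto-late : ∀ o l → K ≤ o → upto (iota o l) ≡ 0
    upto-late o zero K≤o = ≡.refl
    upto-late o (suc l) K≤o = ≡.trans (length-filterᵇ-∷ (λ i → (i ≤ᵇ K) ∧ D i) o (iota (suc o) l))
      (≡.cong₂ (λ b z → tally b ℕ.+ z) (go (ℕ.m≤n⇒m<n∨m≡n K≤o)) (upto-late (suc o) l (ℕ.m≤n⇒m≤1+n K≤o)))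
      where
      go : K < o ⊎ K ≡ o → (o ≤ᵇ K) ∧ D o ≡ false
      go (inj₁ K<o) = ≡.cong (_∧ D o) (≤ᵇ-false K<o)
      go (inj₂ ≡.refl) rewrite DK = ∧-zeroʳ (o ≤ᵇ K)

module Combinatorics where
  open import Data.Nat.Base using (_+_; _*_; _≡ᵇ_; z≤n; z<s; s≤s⁻¹)
  open import Data.Nat.Properties
  open ≡ hiding ([_])
  open ≡.≡-Reasoning
  open import Data.Bool.Base using (T)
  open import Data.Bool.Properties using (T-∧; T?)
  open import Data.List.Base using (filter; applyUpTo; drop)
  open import Data.List.Properties hiding (length-map)
  open import Data.List.Membership.Propositional using (_∉_; find; lose)
  open import Data.List.Membership.Propositional.Properties
  open import Data.List.Membership.Propositional.Properties.WithK using (unique∧set⇒bag)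
  open import Data.List.Relation.Unary.All as All using (All; []; _∷_)
  import Data.List.Relation.Unary.All.Properties as All
  open import Data.List.Relation.Unary.AllPairs as AllPairs using (AllPairs; []; _∷_)
  open import Data.List.Relation.Unary.Linked.Properties using (Linked⇒AllPairs)
  open import Data.List.Relation.Unary.Unique.Propositional using (Unique)
  import Data.List.Relation.Unary.Unique.Propositional.Properties as Unique
  open import Data.List.Relation.Binary.BagAndSetEquality using (∼bag⇒↭)
  open ↭ using (↭-sym; ↭-trans; ↭-reflexive; ↭-prep; ↭⇒↭ₛ)
  open import Data.List.Relation.Binary.Permutation.Propositional.Properties
    using (∈-resp-↭; ↭-length; filter-↭; drop-mid) renaming (map⁺ to ↭-map⁺)
  import Data.List.Relation.Binary.Permutation.Setoid.Properties as Permutationₛ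
  open import Data.List.Sort ℕ.≤-decTotalOrder using (sort; sort-↭; sort-↗)
  open import Function.Base using (_∘_; id)
  open import Function.Bundles using (mk⇔)
  open import Relation.Nullary.Negation using (¬_)
  open import Relation.Nullary.Decidable using (¬?)
  open import Relation.Binary.Definitions using (Tri; tri<; tri≈; tri>)

  -- Duplicate-free lists and intervals

  module _ {A B : Set} {f g : A → B} where

    -- The inverse laws for `nth`, `pos` and `rank` are proved as equations between whole lists,
    -- where induction is easy. This extracts the pointwise laws.
    map-≡⁻ : ∀ {xs} → map f xs ≡ map g xs → ∀ {x} → x ∈ xs → f x ≡ g x
    map-≡⁻ {y ∷ ys} eq (here refl) = ∷-injectiveˡ eq
    map-≡⁻ {y ∷ ys} eq (there x∈) = map-≡⁻ (∷-injectiveʳ eq) x∈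

    map-≡⁺ : ∀ {xs} → (∀ {x} → x ∈ xs → f x ≡ g x) → map f xs ≡ map g xs
    map-≡⁺ eq = map-cong-local (All.tabulate eq)

  -- Injectivity is asked only on the list because a ↦ a ∘ u is injective only among sequences of
  -- the right length.
  unique-map : {A B : Set} {f : A → B} {xs : List A} →
    (∀ {x y} → x ∈ xs → y ∈ xs → f x ≡ f y → x ≡ y) → Unique xs → Unique (map f xs)
  unique-map inj [] = []
  unique-map inj (x∉ ∷ xs!) =
    All.map⁺ (All.tabulate λ y∈ fx≡fy → All.lookup x∉ y∈ (inj (here refl) (there y∈) fx≡fy))
    ∷ unique-map (λ x∈ y∈ → inj (there x∈) (there y∈)) xs!

  -- The retraction `r` names the block an element came from, which keeps distinct blocks disjoint.
  -- It is instantiated by `remove`, `drop 1` and `std`.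
  unique-concatMap : {A B : Set} (g : A → List B) (r : B → A) {xs : List A} → Unique xs →
    (∀ {x} → x ∈ xs → Unique (g x)) → (∀ {x y} → x ∈ xs → y ∈ g x → r y ≡ x) → Unique (concatMap g xs)
  unique-concatMap g r [] g! inv = []
  unique-concatMap g r {x ∷ xs} (x∉ ∷ xs!) g! inv =
    Unique.++⁺ (g! (here refl)) (unique-concatMap g r xs! (g! ∘ there) (inv ∘ there)) disjoint
    where
    disjoint : ∀ {y} → ¬ (y ∈ g x × y ∈ concatMap g xs)
    disjoint (y∈ , y∈′) with x′ , x′∈ , y∈gx′ ← find (∈-concatMap⁻ g y∈′) =
      All.lookup x∉ x′∈ (trans (sym (inv (here refl) y∈)) (inv (there x′∈) y∈gx′))

  unique-resp-↭ : {A : Set} {xs ys : List A} → xs ↭ ys → Unique xs → Unique ys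
  unique-resp-↭ = Permutationₛ.Unique-resp-↭ (setoid _) ∘ ↭⇒↭ₛ

  iota-suc : ∀ o l → iota (suc o) l ≡ map suc (iota o l)
  iota-suc o zero = refl
  iota-suc o (suc l) = cong (suc o ∷_) (iota-suc (suc o) l)

  range1≡iota : ∀ m → range1 m ≡ iota 1 m
  range1≡iota m = trans (map-upTo suc m) (go suc 1 m (λ _ → refl))
    where
    go : ∀ f o l → (∀ i → f i ≡ o + i) → applyUpTo f l ≡ iota o l
    go f o zero eq = refl
    go f o (suc l) eq = cong₂ _∷_ (trans (eq 0) (+-identityʳ o))
      (go (f ∘ suc) (suc o) l (λ i → trans (eq (suc i)) (+-suc o i)))

  length-iota : ∀ o l → length (iota o l) ≡ l
  length-iota o zero = refl
  length-iota o (suc l) = cong suc (length-iota (suc o) l)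

  ∈-iota⁻ : ∀ {i} o l → i ∈ iota o l → o ≤ i × i < o + l
  ∈-iota⁻ o (suc l) (here refl) = ≤-refl , m<m+n o z<s
  ∈-iota⁻ {i} o (suc l) (there i∈) with o<i , i< ← ∈-iota⁻ (suc o) l i∈ =
    <⇒≤ o<i , subst (i <_) (sym (+-suc o l)) i<

  ∈-iota⁺ : ∀ {i} o l → o ≤ i → i < o + l → i ∈ iota o l
  ∈-iota⁺ {i} o zero o≤i i< = contradiction (subst (i <_) (+-identityʳ o) i<) (≤⇒≯ o≤i)
  ∈-iota⁺ {i} o (suc l) o≤i i< with m≤n⇒m<n∨m≡n o≤i
  ... | inj₁ o<i = there (∈-iota⁺ (suc o) l o<i (subst (i <_) (+-suc o l) i<))
  ... | inj₂ refl = here refl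

  iota-∷ʳ : ∀ o l → iota o (suc l) ↭ (o + l) ∷ iota o l
  iota-∷ʳ o zero = ↭-reflexive (cong [_] (sym (+-identityʳ o)))
  iota-∷ʳ o (suc l) = ↭-trans (↭-prep o (iota-∷ʳ (suc o) l))
    (↭-trans (↭.↭-swap o (suc o + l) ↭.↭-refl) (↭-reflexive (cong (_∷ o ∷ iota (suc o) l) (sym (+-suc o l)))))

  module _ {_R_ : ℕ → ℕ → Set} (g : ℕ → ℕ) where

    allPairs-iota⁺ : ∀ o l → (∀ {i j} → o ≤ i → i < j → j < o + l → g i R g j) → AllPairs _R_ (map g (iota o l))
    allPairs-iota⁺ o zero h = []
    allPairs-iota⁺ o (suc l) h =
      All.map⁺ (All.tabulate λ {j} j∈ → let o<j , j< = ∈-iota⁻ (suc o) l j∈ in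
        h ≤-refl o<j (subst (j <_) (sym (+-suc o l)) j<))
      ∷ allPairs-iota⁺ (suc o) l λ {_} {j} o<i i<j j< → h (<⇒≤ o<i) i<j (subst (j <_) (sym (+-suc o l)) j<)

    allPairs-iota⁻ : ∀ o l → AllPairs _R_ (map g (iota o l)) → ∀ {i j} → o ≤ i → i < j → j < o + l → g i R g j
    allPairs-iota⁻ o zero _ {i} {j} o≤i i<j j< =
      contradiction (subst (j <_) (+-identityʳ o) j<) (≤⇒≯ (≤-trans o≤i (<⇒≤ i<j)))
    allPairs-iota⁻ o (suc l) (h ∷ hs) {i} {j} o≤i i<j j< with subst (j <_) (+-suc o l) j< | m≤n⇒m<n∨m≡n o≤i
    ... | j<′ | inj₁ o<i = allPairs-iota⁻ (suc o) l hs o<i i<j j<′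
    ... | j<′ | inj₂ refl = All.lookup (All.map⁻ h) (∈-iota⁺ (suc o) l i<j j<′)

    increasing : (∀ {a b c} → a R b → b R c → a R c) → ∀ {o N} → (∀ {i} → o ≤ i → suc i < N → g i R g (suc i)) →
      ∀ {i j} → o ≤ i → i < j → j < N → g i R g j
    increasing R-trans step {i} {suc j} o≤i i<1+j 1+j<N with m≤n⇒m<n∨m≡n (s≤s⁻¹ i<1+j)
    ... | inj₁ i<j = R-trans (increasing R-trans step o≤i i<j (<⇒≤ 1+j<N)) (step (≤-trans o≤i (<⇒≤ i<j)) 1+j<N)
    ... | inj₂ refl = step o≤i 1+j<N

  unique-iota : ∀ o l → Unique (iota o l)
  unique-iota o l = subst Unique (map-id (iota o l)) (allPairs-iota⁺ id o l λ _ i<j _ → <⇒≢ i<j)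

  -- One-based, as are pos and the maps of Defs.
  nth : List ℕ → ℕ → ℕ
  nth xs i = at xs (i ∸ 1)

  map-nth : ∀ xs → map (nth xs) (iota 1 (length xs)) ≡ xs
  map-nth xs = begin
    map (nth xs) (iota 1 (length xs))           ≡⟨ cong (map (nth xs)) (iota-suc 0 (length xs)) ⟩
    map (nth xs) (map suc (iota 0 (length xs))) ≡⟨ map-∘ (iota 0 (length xs)) ⟨
    map (at xs) (iota 0 (length xs))            ≡⟨ map-at xs ⟩
    xs                                          ∎
    where
    map-at : ∀ xs → map (at xs) (iota 0 (length xs)) ≡ xs
    map-at [] = refl
    map-at (x ∷ xs) = cong (x ∷_) (begin
      map (at (x ∷ xs)) (iota 1 (length xs))           ≡⟨ cong (map (at (x ∷ xs))) (iota-suc 0 (length xs)) ⟩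
      map (at (x ∷ xs)) (map suc (iota 0 (length xs))) ≡⟨ map-∘ (iota 0 (length xs)) ⟨
      map (at xs) (iota 0 (length xs))                 ≡⟨ map-at xs ⟩
      xs                                               ∎)

  nth-map : ∀ (α : ℕ → ℕ) n {i} → i ∈ iota 1 n → nth (map α (iota 1 n)) i ≡ α i
  nth-map α n = map-≡⁻ (begin
    map (nth a) (iota 1 n)          ≡⟨ cong (map (nth a) ∘ iota 1) (trans (length-map α (iota 1 n)) (length-iota 1 n)) ⟨
    map (nth a) (iota 1 (length a)) ≡⟨ map-nth a ⟩
    a                               ∎)
    where a = map α (iota 1 n)

  -- Positions and entries of a word

  ≡ᵇ-refl : ∀ x → (x ≡ᵇ x) ≡ true
  ≡ᵇ-refl x = Equivalence.to T-≡ (≡⇒≡ᵇ x x refl)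

  ≢⇒≡ᵇ-false : ∀ {x y} → x ≢ y → (x ≡ᵇ y) ≡ false
  ≢⇒≡ᵇ-false {x} {y} x≢y with x ≡ᵇ y in eq
  ... | false = refl
  ... | true = contradiction (≡ᵇ⇒≡ x y (Equivalence.from T-≡ eq)) x≢y

  map-pos : ∀ {u} → Unique u → map (pos u) u ≡ iota 1 (length u)
  map-pos [] = refl
  map-pos {x ∷ xs} (x∉ ∷ xs!) = cong₂ _∷_
    (cong (if_then 1 else suc (pos xs x)) (≡ᵇ-refl x))
    (begin
      map (pos (x ∷ xs)) xs
        ≡⟨ map-≡⁺ (λ {y} y∈ → cong (if_then 1 else suc (pos xs y)) (≢⇒≡ᵇ-false (All.lookup x∉ y∈))) ⟩
      map (suc ∘ pos xs) xs         ≡⟨ map-∘ xs ⟩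
      map suc (map (pos xs) xs)     ≡⟨ cong (map suc) (map-pos xs!) ⟩
      map suc (iota 1 (length xs))  ≡⟨ iota-suc 1 (length xs) ⟨
      iota 2 (length xs)            ∎)

  module _ {u : List ℕ} (u! : Unique u) where

    nth-pos : ∀ {i} → i ∈ u → nth u (pos u i) ≡ i
    nth-pos = map-≡⁻ (begin
      map (nth u ∘ pos u) u           ≡⟨ map-∘ u ⟩
      map (nth u) (map (pos u) u)     ≡⟨ cong (map (nth u)) (map-pos u!) ⟩
      map (nth u) (iota 1 (length u)) ≡⟨ map-nth u ⟩
      u                               ≡⟨ map-id u ⟨
      map id u                        ∎)

    pos-nth : ∀ {j} → j ∈ iota 1 (length u) → pos u (nth u j) ≡ j
    pos-nth = map-≡⁻ (begin
      map (pos u ∘ nth u) (iota 1 (length u))   ≡⟨ map-∘ (iota 1 (length u)) ⟩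
      map (pos u) (map (nth u) (iota 1 (length u))) ≡⟨ cong (map (pos u)) (map-nth u) ⟩
      map (pos u) u                             ≡⟨ map-pos u! ⟩
      iota 1 (length u)                         ≡⟨ map-id _ ⟨
      map id (iota 1 (length u))                ∎)

  nth-∈ : ∀ xs {j} → j ∈ iota 1 (length xs) → nth xs j ∈ xs
  nth-∈ xs {j} j∈ = subst (nth xs j ∈_) (map-nth xs) (∈-map⁺ (nth xs) j∈)

  -- Ranks and standardization

  rank : List ℕ → ℕ → ℕ
  rank s k = length (filter (_≤? k) s)

  rank-↭ : ∀ {s t} k → s ↭ t → rank s k ≡ rank t k
  rank-↭ k s↭t = ↭-length (filter-↭ (_≤? k) s↭t)

  map-rank : ∀ {s} → AllPairs _<_ s → map (rank s) s ≡ iota 1 (length s)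
  map-rank [] = refl
  map-rank {x ∷ xs} (x< ∷ xs<) = cong₂ _∷_
    (cong length (trans (filter-accept (_≤? x) ≤-refl) (cong (x ∷_) (filter-none (_≤? x) (All.map <⇒≱ x<)))))
    (begin
      map (rank (x ∷ xs)) xs
        ≡⟨ map-≡⁺ (λ {y} y∈ → cong length (filter-accept (_≤? y) (<⇒≤ (All.lookup x< y∈)))) ⟩
      map (suc ∘ rank xs) xs        ≡⟨ map-∘ xs ⟩
      map suc (map (rank xs) xs)    ≡⟨ cong (map suc) (map-rank xs<) ⟩
      map suc (iota 1 (length xs))  ≡⟨ iota-suc 1 (length xs) ⟨
      iota 2 (length xs)            ∎)

  module _ {s : List ℕ} (s< : AllPairs _<_ s) where

    rank-nth : ∀ {i} → i ∈ iota 1 (length s) → rank s (nth s i) ≡ i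
    rank-nth = map-≡⁻ (begin
      map (rank s ∘ nth s) (iota 1 (length s))       ≡⟨ map-∘ _ ⟩
      map (rank s) (map (nth s) (iota 1 (length s))) ≡⟨ cong (map (rank s)) (map-nth s) ⟩
      map (rank s) s                                 ≡⟨ map-rank s< ⟩
      iota 1 (length s)                              ≡⟨ map-id _ ⟨
      map id (iota 1 (length s))                     ∎)

    nth-rank : ∀ {k} → k ∈ s → nth s (rank s k) ≡ k
    nth-rank = map-≡⁻ (begin
      map (nth s ∘ rank s) s          ≡⟨ map-∘ s ⟩
      map (nth s) (map (rank s) s)    ≡⟨ cong (map (nth s)) (map-rank s<) ⟩
      map (nth s) (iota 1 (length s)) ≡⟨ map-nth s ⟩
      s                               ≡⟨ map-id s ⟨
      map id s                        ∎)

  standardize : List ℕ → List ℕ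
  standardize ks = map (rank ks) ks

  -- Ranks depend only on the multiset of keys, so they can be computed in the sorted list `s`,
  -- where the rank of an entry is its index. This is the uniqueness half: a permutation along which
  -- the keys increase must be the standardization.
  standardize-spec : ∀ {s u} → AllPairs _<_ s → u ↭ iota 1 (length s) → standardize (map (nth s) u) ≡ u
  standardize-spec {s} {u} s< u↭ = begin
    map (rank (map (nth s) u)) (map (nth s) u) ≡⟨ map-cong (λ k → rank-↭ k ks↭s) (map (nth s) u) ⟩
    map (rank s) (map (nth s) u)               ≡⟨ map-∘ u ⟨
    map (rank s ∘ nth s) u                     ≡⟨ map-≡⁺ (λ i∈ → rank-nth s< (∈-resp-↭ u↭ i∈)) ⟩
    map id u                                   ≡⟨ map-id u ⟩
    u                                          ∎
    where
    ks↭s : map (nth s) u ↭ s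
    ks↭s = ↭-trans (↭-map⁺ (nth s) u↭) (↭-reflexive (map-nth s))

  -- The existence half: `s` is the sorted list of keys, strictly increasing because the keys are
  -- distinct.
  standardize-perm : ∀ {ks} → Unique ks → ∃ λ s → AllPairs _<_ s × length s ≡ length ks ×
    standardize ks ↭ iota 1 (length ks) × ks ≡ map (nth s) (standardize ks)
  standardize-perm {ks} ks! = s , s< , |s| , perm , (begin
    ks                               ≡⟨ map-id ks ⟨
    map id ks
      ≡⟨ map-≡⁺ (λ {k} k∈ → trans (cong (nth s) (rank-↭ k (↭-sym s↭ks)))
           (nth-rank s< (∈-resp-↭ (↭-sym s↭ks) k∈))) ⟨
    map (nth s ∘ rank ks) ks         ≡⟨ map-∘ ks ⟩
    map (nth s) (standardize ks)     ∎)
    where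
    s = sort ks
    s↭ks : s ↭ ks
    s↭ks = sort-↭ ks
    |s| : length s ≡ length ks
    |s| = ↭-length s↭ks
    s< : AllPairs _<_ s
    s< = AllPairs.zipWith (λ (x≤y , x≢y) → ≤∧≢⇒< x≤y x≢y)
      (Linked⇒AllPairs ≤-trans (sort-↗ ks) , unique-resp-↭ (↭-sym s↭ks) ks!)
    perm : standardize ks ↭ iota 1 (length ks)
    perm = ↭-trans (↭-map⁺ (rank ks) (↭-sym s↭ks)) (↭-reflexive (begin
      map (rank ks) s   ≡⟨ map-cong (λ k → rank-↭ k (↭-sym s↭ks)) s ⟩
      map (rank s) s    ≡⟨ map-rank s< ⟩
      iota 1 (length s) ≡⟨ cong (iota 1) |s| ⟩
      iota 1 (length ks) ∎))

  -- The lists of permutations and of maps: members, absence of repetition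

  insertAll⁻ : ∀ {l} x ys → l ∈ insertAll x ys → l ↭ x ∷ ys
  insertAll⁻ x [] (here refl) = ↭.↭-refl
  insertAll⁻ x (y ∷ ys) (here refl) = ↭.↭-refl
  insertAll⁻ x (y ∷ ys) (there l∈) with l′ , l′∈ , refl ← ∈-map⁻ (y ∷_) l∈ =
    ↭-trans (↭-prep y (insertAll⁻ x ys l′∈)) (↭.↭-swap y x ↭.↭-refl)

  insertAll⁺ : ∀ x as bs → as ++ x ∷ bs ∈ insertAll x (as ++ bs)
  insertAll⁺ x [] [] = here refl
  insertAll⁺ x [] (b ∷ bs) = here refl
  insertAll⁺ x (a ∷ as) bs = there (∈-map⁺ (a ∷_) (insertAll⁺ x as bs))

  perms⁻ : ∀ n {u} → u ∈ perms n → u ↭ iota 1 n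
  perms⁻ zero (here refl) = ↭.↭-refl
  perms⁻ (suc n) u∈ with v , v∈ , u∈′ ← find (∈-concatMap⁻ (insertAll (suc n)) u∈) =
    ↭-trans (insertAll⁻ (suc n) v u∈′) (↭-trans (↭-prep (suc n) (perms⁻ n v∈)) (↭-sym (iota-∷ʳ 1 n)))

  perms⁺ : ∀ n {u} → u ↭ iota 1 n → u ∈ perms n
  perms⁺ zero {[]} _ = here refl
  perms⁺ zero {_ ∷ _} u↭ with () ← ↭-length u↭
  -- Deleting the largest entry leaves a permutation of [n], and `insertAll` puts that entry back in
  -- the same place.
  perms⁺ (suc n) {u} u↭ with u↭′ ← ↭-trans u↭ (iota-∷ʳ 1 n)
    with as , bs , refl ← ∈-∃++ (∈-resp-↭ (↭-sym u↭′) (here refl)) =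
    ∈-concatMap⁺ (insertAll (suc n)) (lose (perms⁺ n (drop-mid as [] u↭′)) (insertAll⁺ (suc n) as bs))

  insertAll-unique : ∀ {x ys} → x ∉ ys → Unique (insertAll x ys)
  insertAll-unique {x} {[]} x∉ = [] ∷ []
  insertAll-unique {x} {y ∷ ys} x∉ =
    All.tabulate head≢ ∷ Unique.map⁺ ∷-injectiveʳ (insertAll-unique (x∉ ∘ there))
    where
    head≢ : ∀ {l} → l ∈ map (y ∷_) (insertAll x ys) → x ∷ y ∷ ys ≢ l
    head≢ l∈ eq with l′ , _ , refl ← ∈-map⁻ (y ∷_) l∈ = x∉ (here (∷-injectiveˡ eq))

  remove : ℕ → List ℕ → List ℕ
  remove x = filter (λ y → ¬? (y ≟ x))

  remove-insertAll : ∀ {x ys l} → x ∉ ys → l ∈ insertAll x ys → remove x l ≡ ys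
  remove-insertAll {x} {[]} x∉ (here refl) = filter-reject (λ y → ¬? (y ≟ x)) (λ x≢x → x≢x refl)
  remove-insertAll {x} {y ∷ ys} x∉ (here refl) =
    trans (filter-reject (λ y → ¬? (y ≟ x)) (λ x≢x → x≢x refl))
      (filter-all (λ y → ¬? (y ≟ x)) (All.tabulate λ z∈ → λ { refl → x∉ z∈ }))
  remove-insertAll {x} {y ∷ ys} x∉ (there l∈) with l′ , l′∈ , refl ← ∈-map⁻ (y ∷_) l∈ =
    trans (filter-accept (λ y → ¬? (y ≟ x)) (λ { refl → x∉ (here refl) }))
      (cong (y ∷_) (remove-insertAll (x∉ ∘ there) l′∈))

  perms-unique : ∀ n → Unique (perms n)
  perms-unique zero = [] ∷ []
  perms-unique (suc n) = unique-concatMap (insertAll (suc n)) (remove (suc n)) (perms-unique n)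
    (insertAll-unique ∘ fresh) (remove-insertAll ∘ fresh)
    where
    fresh : ∀ {v} → v ∈ perms n → suc n ∉ v
    fresh v∈ n∈ = <-irrefl refl (proj₂ (∈-iota⁻ 1 n (∈-resp-↭ (perms⁻ n v∈) n∈)))

  allMaps⁻ : ∀ n M {f} → f ∈ allMaps n M → length f ≡ n × All (_∈ iota 1 M) f
  allMaps⁻ zero M (here refl) = refl , []
  allMaps⁻ (suc n) M f∈
    with v , v∈ , f∈′ ← find (∈-concatMap⁻ (λ v → map (_∷ v) (range1 M)) {xs = allMaps n M} f∈)
    with x , x∈ , refl ← ∈-map⁻ (_∷ v) f∈′
    with |v| , v⊆ ← allMaps⁻ n M v∈ = cong suc |v| , subst (x ∈_) (range1≡iota M) x∈ ∷ v⊆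

  allMaps⁺ : ∀ n M {f} → length f ≡ n → All (_∈ iota 1 M) f → f ∈ allMaps n M
  allMaps⁺ zero M {[]} refl [] = here refl
  allMaps⁺ (suc n) M {x ∷ v} refl (x∈ ∷ v⊆) = ∈-concatMap⁺ (λ v → map (_∷ v) (range1 M))
    (lose (allMaps⁺ n M refl v⊆) (∈-map⁺ (_∷ v) (subst (x ∈_) (sym (range1≡iota M)) x∈)))

  allMaps-unique : ∀ n M → Unique (allMaps n M)
  allMaps-unique zero M = [] ∷ []
  allMaps-unique (suc n) M = unique-concatMap (λ v → map (_∷ v) (range1 M)) (drop 1) (allMaps-unique n M)
    (λ _ → Unique.map⁺ ∷-injectiveˡ (subst Unique (sym (range1≡iota M)) (unique-iota 1 M)))
    tail-cons
    where
    tail-cons : ∀ {v f} → v ∈ allMaps n M → f ∈ map (_∷ v) (range1 M) → drop 1 f ≡ v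
    tail-cons {v} _ f∈ with _ , _ , refl ← ∈-map⁻ (_∷ v) f∈ = refl

  -- Sequences with prescribed strict gaps

  data Chain (M : ℕ) : List Bool → ℕ → List ℕ → Set where
    [] : ∀ {c} → Chain M [] c []
    link : ∀ {d ds c x a} → tally d + c ≤ x → x ≤ M → Chain M ds x a → Chain M (d ∷ ds) c (x ∷ a)

  Chain-length : ∀ {M ds c a} → Chain M ds c a → length a ≡ length ds
  Chain-length [] = refl
  Chain-length (link _ _ a) = cong suc (Chain-length a)

  mutual
    -- The equation `c + r ≡ M` trades the shrinking room `r` of the enumeration for the fixed upper
    -- bound of `Chain`.
    seqs⁻ : ∀ {M} ds c r → c + r ≡ M → ∀ {a} → a ∈ seqs ds c r → Chain M ds c a
    seqs⁻ [] c r eq (here refl) = []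
    seqs⁻ (false ∷ ds) c r eq a∈ = steps⁻ ds c r eq a∈
    seqs⁻ (true ∷ ds) c (suc r) eq a∈ with steps⁻ ds (suc c) r (trans (sym (+-suc c r)) eq) a∈
    ... | link c< x≤ a = link c< x≤ a

    steps⁻ : ∀ {M} ds c r → c + r ≡ M → ∀ {a} → a ∈ steps ds c r → Chain M (false ∷ ds) c a
    steps⁻ ds c zero eq a∈ with _ , a′∈ , refl ← ∈-map⁻ (c ∷_) a∈ =
      link ≤-refl (m+n≤o⇒m≤o c (≤-reflexive eq)) (seqs⁻ ds c zero eq a′∈)
    steps⁻ ds c (suc r) eq a∈ with ∈-++⁻ (map (c ∷_) (seqs ds c (suc r))) a∈
    ... | inj₁ a∈′ with _ , a′∈ , refl ← ∈-map⁻ (c ∷_) a∈′ =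
      link ≤-refl (m+n≤o⇒m≤o c (≤-reflexive eq)) (seqs⁻ ds c (suc r) eq a′∈)
    ... | inj₂ a∈′ with steps⁻ ds (suc c) r (trans (sym (+-suc c r)) eq) a∈′
    ...   | link c< x≤ a = link (<⇒≤ c<) x≤ a

  mutual
    seqs⁺ : ∀ {M} ds c r → c + r ≡ M → ∀ {a} → Chain M ds c a → a ∈ seqs ds c r
    seqs⁺ [] c r eq [] = here refl
    seqs⁺ (false ∷ ds) c r eq a = steps⁺ ds c r eq a
    seqs⁺ (true ∷ ds) c zero eq (link c< x≤ _) =
      contradiction (≤-trans x≤ (≤-reflexive (trans (sym eq) (+-identityʳ c)))) (<⇒≱ c<)
    seqs⁺ (true ∷ ds) c (suc r) eq (link c< x≤ a) =
      steps⁺ ds (suc c) r (trans (sym (+-suc c r)) eq) (link c< x≤ a)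

    steps⁺ : ∀ {M} ds c r → c + r ≡ M → ∀ {a} → Chain M (false ∷ ds) c a → a ∈ steps ds c r
    steps⁺ ds c zero eq (link c≤ x≤ a)
      with refl ← ≤-antisym c≤ (≤-trans x≤ (≤-reflexive (trans (sym eq) (+-identityʳ c)))) =
      ∈-map⁺ (c ∷_) (seqs⁺ ds c zero eq a)
    steps⁺ ds c (suc r) eq (link c≤ x≤ a) with m≤n⇒m<n∨m≡n c≤
    ... | inj₁ c< = ∈-++⁺ʳ (map (c ∷_) (seqs ds c (suc r)))
      (steps⁺ ds (suc c) r (trans (sym (+-suc c r)) eq) (link c< x≤ a))
    ... | inj₂ refl = ∈-++⁺ˡ (∈-map⁺ (c ∷_) (seqs⁺ ds c (suc r) eq a))

  mutual
    seqs-unique : ∀ ds c r → Unique (seqs ds c r)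
    seqs-unique [] c r = [] ∷ []
    seqs-unique (false ∷ ds) c r = steps-unique ds c r
    seqs-unique (true ∷ ds) c zero = []
    seqs-unique (true ∷ ds) c (suc r) = steps-unique ds (suc c) r

    steps-unique : ∀ ds c r → Unique (steps ds c r)
    steps-unique ds c zero = Unique.map⁺ ∷-injectiveʳ (seqs-unique ds c zero)
    steps-unique ds c (suc r) =
      Unique.++⁺ (Unique.map⁺ ∷-injectiveʳ (seqs-unique ds c (suc r))) (steps-unique ds (suc c) r) disjoint
      where
      disjoint : ∀ {a} → ¬ (a ∈ map (c ∷_) (seqs ds c (suc r)) × a ∈ steps ds (suc c) r)
      disjoint (a∈ , a∈′) with _ , _ , refl ← ∈-map⁻ (c ∷_) a∈ with steps⁻ ds (suc c) r refl a∈′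
      ... | link c<c _ _ = <-irrefl refl c<c

  module _ {M : ℕ} (D : ℕ → Bool) (α : ℕ → ℕ) where

    chain⁺ : ∀ o l → (∀ {i} → o ≤ i → i < o + l → tally (D i) + α i ≤ α (suc i)) →
      (∀ {i} → o < i → i ≤ o + l → α i ≤ M) → Chain M (map D (iota o l)) (α o) (map α (iota (suc o) l))
    chain⁺ o zero step bound = []
    chain⁺ o (suc l) step bound = link (step ≤-refl (m<m+n o z<s))
      (bound (n<1+n o) (≤-trans (s≤s (m≤m+n o l)) (≤-reflexive (sym (+-suc o l)))))
      (chain⁺ (suc o) l (λ {i} o<i i< → step (<⇒≤ o<i) (subst (i <_) (sym (+-suc o l)) i<))
        (λ {i} o<i i≤ → bound (<⇒≤ o<i) (subst (i ≤_) (sym (+-suc o l)) i≤)))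

    chain-step : ∀ o l → Chain M (map D (iota o l)) (α o) (map α (iota (suc o) l)) →
      ∀ {i} → o ≤ i → i < o + l → tally (D i) + α i ≤ α (suc i)
    chain-step o zero _ {i} o≤i i< = contradiction (subst (i <_) (+-identityʳ o) i<) (≤⇒≯ o≤i)
    chain-step o (suc l) (link h _ hs) {i} o≤i i< with m≤n⇒m<n∨m≡n o≤i
    ... | inj₁ o<i = chain-step (suc o) l hs o<i (subst (i <_) (+-suc o l) i<)
    ... | inj₂ refl = h

  chain-bounds : ∀ {M ds c a} → Chain M ds c a → All (λ x → c ≤ x × x ≤ M) a
  chain-bounds [] = []
  chain-bounds {c = c} (link {d} c≤ x≤ a) =
    (m+n≤o⇒n≤o (tally d) c≤ , x≤) ∷
    All.map (λ (x≤y , y≤) → ≤-trans (m+n≤o⇒n≤o (tally d) c≤) x≤y , y≤) (chain-bounds a)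

  -- Weak and strict alternation, treated together through the comparison `r`

  alt : (ℕ → ℕ → Bool) → ℕ → List ℕ → Bool
  alt r j (a ∷ b ∷ rest) = (if odd j then r a b else r b a) ∧ alt r (suc j) (b ∷ rest)
  alt r j _ = true

  altF≡alt : ∀ j xs → altF j xs ≡ alt _≤ᵇ_ j xs
  altF≡alt j [] = refl
  altF≡alt j (a ∷ []) = refl
  altF≡alt j (a ∷ b ∷ rest) = cong (_ ∧_) (altF≡alt (suc j) (b ∷ rest))

  altU≡alt : ∀ j xs → altU j xs ≡ alt _<ᵇ_ j xs
  altU≡alt j [] = refl
  altU≡alt j (a ∷ []) = refl
  altU≡alt j (a ∷ b ∷ rest) = cong (_ ∧_) (altU≡alt (suc j) (b ∷ rest))

  Zigzag : (ℕ → ℕ → Set) → ℕ → ℕ → (ℕ → ℕ) → Set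
  Zigzag _R_ o N g = ∀ {j} → o ≤ j → suc j < N →
    (odd j ≡ true → g j R g (suc j)) × (odd j ≡ false → g (suc j) R g j)

  module _ (r : ℕ → ℕ → Bool) (g : ℕ → ℕ) where

    alt⁻ : ∀ o l → T (alt r o (map g (iota o l))) → Zigzag (λ x y → T (r x y)) o (o + l) g
    alt⁻ o zero _ {j} o≤j j< =
      contradiction (subst (suc j <_) (+-identityʳ o) j<) (≤⇒≯ (m≤n⇒m≤1+n o≤j))
    alt⁻ o (suc zero) _ {j} o≤j j< =
      contradiction (subst (suc j <_) (+-comm o 1) j<) (≤⇒≯ (s≤s o≤j))
    alt⁻ o (suc (suc l)) h {j} o≤j j< =
      cases (alt⁻ (suc o) (suc l) (proj₂ (Equivalence.to T-∧ h))) (m≤n⇒m<n∨m≡n o≤j)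
      where
      goal : ℕ → Set
      goal j = (odd j ≡ true → T (r (g j) (g (suc j)))) × (odd j ≡ false → T (r (g (suc j)) (g j)))
      first : T (if odd o then r (g o) (g (suc o)) else r (g (suc o)) (g o))
      first = proj₁ (Equivalence.to T-∧ h)
      cases : Zigzag (λ x y → T (r x y)) (suc o) (suc o + suc l) g → o < j ⊎ o ≡ j → goal j
      cases rest (inj₁ o<j) = rest o<j (subst (suc j <_) (+-suc o (suc l)) j<)
      cases rest (inj₂ refl) =
        (λ eq → subst (λ b → T (if b then r (g o) (g (suc o)) else r (g (suc o)) (g o))) eq first) ,
        (λ eq → subst (λ b → T (if b then r (g o) (g (suc o)) else r (g (suc o)) (g o))) eq first)

    alt⁺ : ∀ o l → Zigzag (λ x y → T (r x y)) o (o + l) g → T (alt r o (map g (iota o l)))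
    alt⁺ o zero _ = _
    alt⁺ o (suc zero) _ = _
    alt⁺ o (suc (suc l)) h = Equivalence.from T-∧
      ( first (odd o) refl
      , alt⁺ (suc o) (suc l) λ {j} o<j j< → h (<⇒≤ o<j) (subst (suc j <_) (sym (+-suc o (suc l))) j<))
      where
      h₀ : (odd o ≡ true → T (r (g o) (g (suc o)))) × (odd o ≡ false → T (r (g (suc o)) (g o)))
      h₀ = h ≤-refl (subst (suc o <_) (sym (trans (+-suc o (suc l)) (cong suc (+-suc o l)))) (s≤s (s≤s (m≤m+n o l))))
      first : ∀ b → odd o ≡ b → T (if b then r (g o) (g (suc o)) else r (g (suc o)) (g o))
      first true eq = proj₁ h₀ eq
      first false eq = proj₂ h₀ eq

  module _ {R S : ℕ → ℕ → Set} where
    zigzag-map : ∀ {o N g h} →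
      (∀ {i j} → o ≤ i → i < N → o ≤ j → j < N → R (g i) (g j) → S (h i) (h j)) →
      Zigzag R o N g → Zigzag S o N h
    zigzag-map imp z o≤j j< =
      (λ eq → imp o≤j (<⇒≤ j<) (m≤n⇒m≤1+n o≤j) j< (proj₁ (z o≤j j<) eq)) ,
      (λ eq → imp (m≤n⇒m≤1+n o≤j) j< o≤j (<⇒≤ j<) (proj₂ (z o≤j j<) eq))

  -- Realises the order 1 < 3 < 2 < 5 < 4 < ⋯ on positions.
  ω : ℕ → ℕ
  ω j = if odd j then 2 * j else 2 * j + 3

  ω-lower : ∀ j → 2 * j ≤ ω j
  ω-lower j with odd j
  ... | true = ≤-refl
  ... | false = m≤m+n (2 * j) 3

  ω-upper : ∀ j → ω j ≤ 2 * j + 3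
  ω-upper j with odd j
  ... | true = m≤m+n (2 * j) 3
  ... | false = ≤-refl

  -- The offset 3 lies strictly between 2 and 4: an even position moves past its successor but past
  -- no later one.
  ω-far : ∀ j k → suc j < k → ω j < ω k
  ω-far j k 1+j<k = ≤-Reasoning.begin-strict
    ω j           ≤-Reasoning.≤⟨ ω-upper j ⟩
    2 * j + 3     ≤-Reasoning.<⟨ +-monoʳ-< (2 * j) (n<1+n 3) ⟩
    2 * j + 4     ≤-Reasoning.≡⟨ trans (+-comm (2 * j) 4) (sym (*-distribˡ-+ 2 2 j)) ⟩
    2 * (2 + j)   ≤-Reasoning.≤⟨ *-monoʳ-≤ 2 1+j<k ⟩
    2 * k         ≤-Reasoning.≤⟨ ω-lower k ⟩
    ω k           ≤-Reasoning.∎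

  ω-odd : ∀ j → odd j ≡ true → ω j < ω (suc j)
  ω-odd j eq rewrite eq = ≤-<-trans (*-monoʳ-≤ 2 (n≤1+n j)) (m<m+n (2 * suc j) z<s)

  ω-even : ∀ j → odd j ≡ false → ω (suc j) < ω j
  ω-even j eq rewrite eq =
    subst (_< 2 * j + 3) (sym (trans (*-distribˡ-+ 2 1 j) (+-comm 2 (2 * j)))) (+-monoʳ-< (2 * j) (n<1+n 2))

  odd-or-even : ∀ j → odd j ≡ true ⊎ odd j ≡ false
  odd-or-even j with odd j
  ... | true = inj₁ refl
  ... | false = inj₂ refl

  ω-distinct : ∀ j k → j < k → ω j < ω k ⊎ ω k < ω j
  ω-distinct j k j<k with m≤n⇒m<n∨m≡n j<k
  ... | inj₁ 1+j<k = inj₁ (ω-far j k 1+j<k)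
  ... | inj₂ refl with odd-or-even j
  ...   | inj₁ eq = inj₁ (ω-odd j eq)
  ...   | inj₂ eq = inj₂ (ω-even j eq)

  -- Lexicographic keys with ties broken by `ω`

  module Keys (f : List ℕ) where

    n : ℕ
    n = length f

    -- The pair (f(j), ω(j)) in lexicographic order: 2n + 4 exceeds every ω(j) with j ≤ n.
    κ : ℕ → ℕ
    κ j = nth f j * (2 * n + 4) + ω j

    κ-lex : ∀ j k → j ≤ n → nth f j < nth f k → κ j < κ k
    κ-lex j k j≤n fj<fk = ≤-Reasoning.begin-strict
      nth f j * B + ω j  ≤-Reasoning.<⟨ +-monoʳ-< (nth f j * B) ω<B ⟩
      nth f j * B + B    ≤-Reasoning.≡⟨ +-comm (nth f j * B) B ⟩
      suc (nth f j) * B  ≤-Reasoning.≤⟨ *-monoˡ-≤ B fj<fk ⟩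
      nth f k * B        ≤-Reasoning.≤⟨ m≤m+n (nth f k * B) (ω k) ⟩
      κ k                ≤-Reasoning.∎
      where
      B = 2 * n + 4
      ω<B : ω j < B
      ω<B = ≤-<-trans (ω-upper j) (+-mono-≤-< (*-monoʳ-≤ 2 j≤n) (n<1+n 3))

    κ-tie : ∀ j k → nth f j ≡ nth f k → ω j < ω k → κ j < κ k
    κ-tie j k eq ωj<ωk = subst (λ x → nth f j * (2 * n + 4) + ω j < x * (2 * n + 4) + ω k) eq
      (+-monoʳ-< (nth f j * (2 * n + 4)) ωj<ωk)

    κ⇒≤ : ∀ j k → k ≤ n → κ j < κ k → nth f j ≤ nth f k
    κ⇒≤ j k k≤n κj<κk = ≮⇒≥ λ fk<fj → <-asym κj<κk (κ-lex k j k≤n fk<fj)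

    κ-tie⁻ : ∀ j k → nth f j ≡ nth f k → κ j < κ k → ω j < ω k
    κ-tie⁻ j k eq κj<κk = +-cancelˡ-< (nth f j * (2 * n + 4)) (ω j) (ω k)
      (subst (λ x → κ j < x * (2 * n + 4) + ω k) (sym eq) κj<κk)

    κ-distinct : ∀ {j k} → j < k → k ≤ n → κ j ≢ κ k
    κ-distinct {j} {k} j<k k≤n eq with <-cmp (nth f j) (nth f k)
    ... | tri< fj<fk _ _ = <⇒≢ (κ-lex j k (≤-trans (<⇒≤ j<k) k≤n) fj<fk) eq
    ... | tri> _ _ fk<fj = <⇒≢ (κ-lex k j k≤n fk<fj) (sym eq)
    ... | tri≈ _ fj≡fk _ with ω-distinct j k j<k
    ...   | inj₁ lt = <⇒≢ (κ-tie j k fj≡fk lt) eq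
    ...   | inj₂ gt = <⇒≢ (κ-tie k j (sym fj≡fk) gt) (sym eq)

    keys : List ℕ
    keys = map κ (iota 1 n)

    keys-unique : Unique keys
    keys-unique = allPairs-iota⁺ κ 1 n λ _ j<k k<1+n → κ-distinct j<k (s≤s⁻¹ k<1+n)

  open Keys using (κ; keys; κ-lex; κ-tie; κ⇒≤; κ-tie⁻; keys-unique)

  std : List ℕ → List ℕ
  std f = standardize (keys f)

  -- Permutations of [n] as words

  module _ {n : ℕ} {u : List ℕ} (u↭ : u ↭ iota 1 n) where

    perm-unique : Unique u
    perm-unique = unique-resp-↭ (↭-sym u↭) (unique-iota 1 n)

    perm-length : length u ≡ n
    perm-length = trans (↭-length u↭) (length-iota 1 n)

    perm-map-pos : map (pos u) u ≡ iota 1 n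
    perm-map-pos = trans (map-pos perm-unique) (cong (iota 1) perm-length)

    perm-map-nth : map (nth u) (iota 1 n) ≡ u
    perm-map-nth = subst (λ m → map (nth u) (iota 1 m) ≡ u) perm-length (map-nth u)

    module _ {i : ℕ} (1≤i : 1 ≤ i) (i≤n : i ≤ n) where

      perm-∈ : i ∈ u
      perm-∈ = ∈-resp-↭ (↭-sym u↭) (∈-iota⁺ 1 n 1≤i (s≤s i≤n))

      perm-pos : 1 ≤ pos u i × pos u i ≤ n
      perm-pos with 1≤ , <1+n ← ∈-iota⁻ 1 n (subst (pos u i ∈_) perm-map-pos (∈-map⁺ (pos u) perm-∈)) = 1≤ , s≤s⁻¹ <1+n

      perm-nth-pos : nth u (pos u i) ≡ i
      perm-nth-pos = nth-pos perm-unique perm-∈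

      perm-nth : 1 ≤ nth u i × nth u i ≤ n
      perm-nth with 1≤ , <1+n ← ∈-iota⁻ 1 n (∈-resp-↭ u↭
        (subst (nth u i ∈_) perm-map-nth (∈-map⁺ (nth u) (∈-iota⁺ 1 n 1≤i (s≤s i≤n))))) = 1≤ , s≤s⁻¹ <1+n

      perm-pos-nth : pos u (nth u i) ≡ i
      perm-pos-nth = pos-nth perm-unique (subst (λ m → i ∈ iota 1 m) (sym perm-length) (∈-iota⁺ 1 n 1≤i (s≤s i≤n)))

  -- From compatibility with `u` to standardization `u`

  module _ (f : List ℕ) {u : List ℕ} (u↭ : u ↭ iota 1 (length f)) where
    private
      n = length f
      β : ℕ → ℕ
      β = κ f ∘ pos u

    value : ℕ → ℕ
    value i = nth f (pos u i)

    -- The condition that cuts out a fibre: for alternating `u` it amounts to `std f ≡ u`, by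
    -- `compatible⇒std` and `std-compatible`.
    Compatible : Set
    Compatible = ∀ {i} → 1 ≤ i → i < n → tally (inRet u i) + value i ≤ value (suc i)

    keys≡ : keys f ≡ map β u
    keys≡ = trans (cong (map (κ f)) (sym (perm-map-pos u↭))) (sym (map-∘ u))

    values≡ : map value u ≡ f
    values≡ = begin
      map value u               ≡⟨ map-∘ u ⟩
      map (nth f) (map (pos u) u) ≡⟨ cong (map (nth f)) (perm-map-pos u↭) ⟩
      map (nth f) (iota 1 n)    ≡⟨ map-nth f ⟩
      f                         ∎

    sorted⇒std : AllPairs _<_ (map β (iota 1 n)) → std f ≡ u
    sorted⇒std s< = begin
      standardize (keys f)        ≡⟨ cong standardize keys≡ ⟩
      standardize (map β u)       ≡⟨ cong standardize (map-≡⁺ λ i∈ → nth-map β n (∈-resp-↭ u↭ i∈)) ⟨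
      standardize (map (nth s) u) ≡⟨ standardize-spec s< (subst (λ m → u ↭ iota 1 m) (sym |s|) u↭) ⟩
      u                           ∎
      where
      s = map β (iota 1 n)
      |s| : length s ≡ n
      |s| = trans (length-map β (iota 1 n)) (length-iota 1 n)

    -- It suffices that the keys increase along u⁻¹(1), u⁻¹(2), .... A strict rise of the value
    -- decides at once. In a tie `i` is not a return, so the position of `i` exceeds that of `i + 1`
    -- by at most 1. Positions in order and at least two apart are settled by `ω-far`; for
    -- neighbours, alternation of `u` fixes the parity of the left one, and `ω` agrees.
    compatible⇒std : Zigzag _<_ 1 (suc n) (nth u) → Compatible → std f ≡ u
    compatible⇒std zz comp = sorted⇒std (allPairs-iota⁺ β 1 n (increasing {_<_} β <-trans step))
      where
      step : ∀ {i} → 1 ≤ i → suc i < suc n → β i < β (suc i)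
      step {i} 1≤i (s≤s i<n)
        with m≤n⇒m<n∨m≡n (m+n≤o⇒n≤o (tally (inRet u i)) (comp 1≤i i<n))
      ... | inj₁ lt = κ-lex f (pos u i) (pos u (suc i)) (proj₂ (perm-pos u↭ 1≤i (<⇒≤ i<n))) lt
      ... | inj₂ tie = κ-tie f x y tie (ω< (<-cmp x y))
        where
        x = pos u i
        y = pos u (suc i)
        1≤x = proj₁ (perm-pos u↭ 1≤i (<⇒≤ i<n))
        x≤n = proj₂ (perm-pos u↭ 1≤i (<⇒≤ i<n))
        1≤y = proj₁ (perm-pos u↭ (m≤n⇒m≤1+n 1≤i) i<n)
        y≤n = proj₂ (perm-pos u↭ (m≤n⇒m≤1+n 1≤i) i<n)
        u[x] : nth u x ≡ i
        u[x] = perm-nth-pos u↭ 1≤i (<⇒≤ i<n)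
        u[y] : nth u y ≡ suc i
        u[y] = perm-nth-pos u↭ (m≤n⇒m≤1+n 1≤i) i<n

        x≤1+y : x ≤ suc y
        x≤1+y = ≮⇒≥ λ 1+y<x → <-irrefl tie
          (subst (λ b → tally b + value i ≤ value (suc i)) (<ᵇ-true 1+y<x) (comp 1≤i i<n))

        ω< : Tri (x < y) (x ≡ y) (y < x) → ω x < ω y
        ω< (tri≈ _ x≡y _) = contradiction (trans (sym u[x]) (trans (cong (nth u) x≡y) u[y])) (<⇒≢ (n<1+n i))
        ω< (tri< x<y _ _) with m≤n⇒m<n∨m≡n x<y
        ... | inj₁ 1+x<y = ω-far x y 1+x<y
        ... | inj₂ 1+x≡y with odd-or-even x
        ...   | inj₁ eq = subst (λ z → ω x < ω z) 1+x≡y (ω-odd x eq)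
        ...   | inj₂ eq = contradiction
          (subst₂ _<_ (trans (cong (nth u) 1+x≡y) u[y]) u[x] (proj₂ (zz 1≤x (s≤s (subst (_≤ n) (sym 1+x≡y) y≤n))) eq))
          (<⇒≯ (n<1+n i))
        -- Here `u` falls from `i + 1` at `y` to `i` at `y + 1`, so `y` is even, which is where `ω`
        -- reverses neighbours.
        ω< (tri> _ _ y<x) with ≤-antisym x≤1+y y<x
        ... | x≡1+y with odd-or-even y
        ...   | inj₁ eq = contradiction
          (subst₂ _<_ u[y] (trans (cong (nth u) (sym x≡1+y)) u[x]) (proj₁ (zz 1≤y (s≤s (subst (_≤ n) x≡1+y x≤n))) eq))
          (<⇒≯ (n<1+n i))
        ...   | inj₂ eq = subst (λ z → ω z < ω y) (sym x≡1+y) (ω-even y eq)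

    -- `f` is `u` followed by the weakly increasing `value`, so each strict inequality of `u`
    -- becomes a weak one of `f`.
    compatible⇒alt : Zigzag _<_ 1 (suc n) (nth u) → Compatible → Zigzag _≤_ 1 (suc n) (nth f)
    compatible⇒alt zz comp = zigzag-map {_<_} {_≤_} {g = nth u} {h = nth f} mono zz
      where
      mono : ∀ {j k} → 1 ≤ j → j < suc n → 1 ≤ k → k < suc n → nth u j < nth u k → nth f j ≤ nth f k
      mono 1≤j (s≤s j≤n) 1≤k (s≤s k≤n) uj<uk = subst₂ _≤_
        (cong (nth f) (perm-pos-nth u↭ 1≤j j≤n)) (cong (nth f) (perm-pos-nth u↭ 1≤k k≤n))
        (increasing {_≤_} value ≤-trans {N = suc n}
          (λ {i} 1≤i i<n → m+n≤o⇒n≤o (tally (inRet u i)) (comp 1≤i (s≤s⁻¹ i<n)))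
          (proj₁ (perm-nth u↭ 1≤j j≤n)) uj<uk (s≤s (proj₂ (perm-nth u↭ 1≤k k≤n))))

  -- The standardization of a map

  module _ (f : List ℕ) where
    private
      n = length f
      u = std f

    std-perm : u ↭ iota 1 n
    std-perm = subst (λ m → u ↭ iota 1 m) (trans (length-map (κ f) (iota 1 n)) (length-iota 1 n))
      (proj₁ (proj₂ (proj₂ (proj₂ (standardize-perm (keys-unique f))))))

    std-sorted : AllPairs _<_ (map (κ f ∘ pos u) (iota 1 n))
    std-sorted with s , s< , |s| , _ , keys≡s ← standardize-perm (keys-unique f) = subst (AllPairs _<_) s≡ s<
      where
      |s|≡n : length s ≡ n
      |s|≡n = trans |s| (trans (length-map (κ f) (iota 1 n)) (length-iota 1 n))
      s≡ : s ≡ map (κ f ∘ pos u) (iota 1 n)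
      s≡ = begin
        s                          ≡⟨ map-nth s ⟨
        map (nth s) (iota 1 (length s)) ≡⟨ cong (map (nth s) ∘ iota 1) |s|≡n ⟩
        map (nth s) (iota 1 n)
          ≡⟨ map-≡⁺ (λ i∈ → map-≡⁻ (trans (sym keys≡s) (keys≡ f std-perm)) (∈-resp-↭ (↭-sym std-perm) i∈)) ⟩
        map (κ f ∘ pos u) (iota 1 n) ∎

    std-increasing : ∀ {i j} → 1 ≤ i → i < j → j ≤ n → κ f (pos u i) < κ f (pos u j)
    std-increasing 1≤i i<j j≤n = allPairs-iota⁻ (κ f ∘ pos u) 1 n std-sorted 1≤i i<j (s≤s j≤n)

    -- Increasing keys force weakly increasing values. At a return the positions jump back by at
    -- least two, so `ω` falls, and equal values would make the keys fall as well.
    std-compatible : Compatible f std-perm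
    std-compatible {i} 1≤i i<n = by-flag (inRet u i) refl
      where
      κ< : κ f (pos u i) < κ f (pos u (suc i))
      κ< = std-increasing 1≤i (n<1+n i) i<n
      f≤ : value f std-perm i ≤ value f std-perm (suc i)
      f≤ = κ⇒≤ f (pos u i) (pos u (suc i)) (proj₂ (perm-pos std-perm (m≤n⇒m≤1+n 1≤i) i<n)) κ<
      by-flag : ∀ b → inRet u i ≡ b → tally b + value f std-perm i ≤ value f std-perm (suc i)
      by-flag false _ = f≤
      by-flag true ret = ≤∧≢⇒< f≤ λ tie → <-asym (κ-tie⁻ f (pos u i) (pos u (suc i)) tie κ<)
        (ω-far (pos u (suc i)) (pos u i) (<ᵇ⇒< (suc (pos u (suc i))) (pos u i) (Equivalence.from T-≡ ret)))

    -- Here `ω` has to extend the zigzag order: it turns a weak inequality between neighbouring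
    -- values, equality included, into a strict one between keys, and `u` orders positions as the
    -- keys do.
    std-alt : Zigzag _≤_ 1 (suc n) (nth f) → Zigzag _<_ 1 (suc n) (nth u)
    std-alt zz {j} 1≤j (s≤s j<n) =
      (λ eq → reflect j (suc j) 1≤j (<⇒≤ j<n) 1≤1+j j<n
        (κ-step j (suc j) (proj₁ (zz 1≤j (s≤s j<n)) eq) (<⇒≤ j<n) (ω-odd j eq))) ,
      (λ eq → reflect (suc j) j 1≤1+j j<n 1≤j (<⇒≤ j<n)
        (κ-step (suc j) j (proj₂ (zz 1≤j (s≤s j<n)) eq) j<n (ω-even j eq)))
      where
      1≤1+j = m≤n⇒m≤1+n 1≤j

      κ-step : ∀ j k → nth f j ≤ nth f k → j ≤ n → ω j < ω k → κ f j < κ f k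
      κ-step j k f≤ j≤n ω< with m≤n⇒m<n∨m≡n f≤
      ... | inj₁ lt = κ-lex f j k j≤n lt
      ... | inj₂ tie = κ-tie f j k tie ω<

      reflect : ∀ j k → 1 ≤ j → j ≤ n → 1 ≤ k → k ≤ n → κ f j < κ f k → nth u j < nth u k
      reflect j k 1≤j j≤n 1≤k k≤n κ< with <-cmp (nth u j) (nth u k)
      ... | tri< lt _ _ = lt
      ... | tri≈ _ eq _ = contradiction
        (cong (κ f) (trans (sym (perm-pos-nth std-perm 1≤j j≤n))
          (trans (cong (pos u) eq) (perm-pos-nth std-perm 1≤k k≤n)))) (<⇒≢ κ<)
      ... | tri> _ _ gt = contradiction
        (subst₂ (λ x y → κ f x < κ f y) (perm-pos-nth std-perm 1≤k k≤n) (perm-pos-nth std-perm 1≤j j≤n)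
          (std-increasing (proj₁ (perm-nth std-perm 1≤k k≤n)) gt (proj₂ (perm-nth std-perm 1≤j j≤n)))) (<⇒≯ κ<)

  -- Membership in the two alternating families

  Uset⁻ : ∀ n {u} → u ∈ Uset n → u ↭ iota 1 n × Zigzag _<_ 1 (suc n) (nth u)
  Uset⁻ n {u} u∈ with u∈perms , alternating ← ∈-filter⁻ (T? ∘ altU 1) {xs = perms n} u∈ =
    u↭ , zigzag-map {λ x y → T (x <ᵇ y)} {_<_} {g = nth u} {nth u} (λ {i} {j} _ _ _ _ → <ᵇ⇒< (nth u i) (nth u j))
      (alt⁻ _<ᵇ_ (nth u) 1 n (subst T (trans (altU≡alt 1 u) (cong (alt _<ᵇ_ 1) (sym (perm-map-nth u↭)))) alternating))
    where
    u↭ : u ↭ iota 1 n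
    u↭ = perms⁻ n u∈perms

  Uset⁺ : ∀ n {u} → u ↭ iota 1 n → Zigzag _<_ 1 (suc n) (nth u) → u ∈ Uset n
  Uset⁺ n {u} u↭ zz = ∈-filter⁺ (T? ∘ altU 1) (perms⁺ n u↭)
    (subst T (trans (cong (alt _<ᵇ_ 1) (perm-map-nth u↭)) (sym (altU≡alt 1 u)))
      (alt⁺ _<ᵇ_ (nth u) 1 n (zigzag-map {_<_} {λ x y → T (x <ᵇ y)} {g = nth u} {nth u} (λ _ _ _ _ → <⇒<ᵇ) zz)))

  Uset-unique : ∀ n → Unique (Uset n)
  Uset-unique n = Unique.filter⁺ (T? ∘ altU 1) (perms-unique n)

  𝒜⁻ : ∀ n M {f} → f ∈ 𝒜 n M → length f ≡ n × All (_∈ iota 1 M) f × Zigzag _≤_ 1 (suc (length f)) (nth f)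
  𝒜⁻ n M {f} f∈ with f∈maps , alternating ← ∈-filter⁻ (T? ∘ altF 1) {xs = allMaps n M} f∈
    with |f| , f⊆ ← allMaps⁻ n M f∈maps =
    |f| , f⊆ , zigzag-map {λ x y → T (x ≤ᵇ y)} {_≤_} {g = nth f} {nth f} (λ {i} {j} _ _ _ _ → ≤ᵇ⇒≤ (nth f i) (nth f j))
      (alt⁻ _≤ᵇ_ (nth f) 1 (length f)
        (subst T (trans (altF≡alt 1 f) (cong (alt _≤ᵇ_ 1) (sym (map-nth f)))) alternating))

  𝒜⁺ : ∀ n M {f} → length f ≡ n → All (_∈ iota 1 M) f → Zigzag _≤_ 1 (suc (length f)) (nth f) → f ∈ 𝒜 n M
  𝒜⁺ n M {f} |f| f⊆ zz = ∈-filter⁺ (T? ∘ altF 1) (allMaps⁺ n M |f| f⊆)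
    (subst T (trans (cong (alt _≤ᵇ_ 1) (map-nth f)) (sym (altF≡alt 1 f)))
      (alt⁺ _≤ᵇ_ (nth f) 1 (length f)
        (zigzag-map {_≤_} {λ x y → T (x ≤ᵇ y)} {g = nth f} {nth f} (λ _ _ _ _ → ≤⇒≤ᵇ) zz)))

  𝒜-unique : ∀ n M → Unique (𝒜 n M)
  𝒜-unique n M = Unique.filter⁺ (T? ∘ altF 1) (allMaps-unique n M)

  -- The gap before a₁ is never forced to be positive; this false is not inRet u 0, which is junk.
  flags : ℕ → List ℕ → List Bool
  flags l u = false ∷ map (inRet u) (iota 1 l)

  -- Parameters are shifted: n is `suc l` and the largest value is `suc m`, so a sequence starts at
  -- 1 with `m` units of room.
  fibre : ℕ → ℕ → List ℕ → List (List ℕ)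
  fibre l m u = map (λ a → map (nth a) u) (seqs (flags l u) 1 m)

  -- Fibres of standardization

  module _ (l m : ℕ) where

    module _ {u a : List ℕ} (u∈ : u ∈ Uset (suc l)) (a∈ : a ∈ seqs (flags l u) 1 m) where
      private
        f = map (nth a) u
        u↭ : u ↭ iota 1 (suc l)
        u↭ = proj₁ (Uset⁻ (suc l) u∈)
        chain : Chain (suc m) (flags l u) 1 a
        chain = seqs⁻ (flags l u) 1 m refl a∈
        |a| : length a ≡ suc l
        |a| = trans (Chain-length chain) (cong suc (trans (length-map (inRet u) (iota 1 l)) (length-iota 1 l)))
        a≡ : map (nth a) (iota 1 (suc l)) ≡ a
        a≡ = subst (λ n → map (nth a) (iota 1 n) ≡ a) |a| (map-nth a)

      fibre-length : length f ≡ suc l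
      fibre-length = trans (length-map (nth a) u) (perm-length u↭)

      private
        u↭f : u ↭ iota 1 (length f)
        u↭f = subst (λ n → u ↭ iota 1 n) (sym fibre-length) u↭

        value≡ : ∀ {i} → i ∈ iota 1 (suc l) → nth f (pos u i) ≡ nth a i
        value≡ i∈ = map-≡⁻ (values≡ f u↭f) (∈-resp-↭ (↭-sym u↭) i∈)

      -- Reading `f` along u⁻¹ undoes a ↦ a ∘ u, which makes that map injective on the sequences
      -- listed for `u`.
      fibre-recover : map (λ i → nth f (pos u i)) (iota 1 (suc l)) ≡ a
      fibre-recover = trans (map-≡⁺ value≡) a≡

      fibre-bounds : All (_∈ iota 1 (suc m)) f
      fibre-bounds = All.map⁺ (All.tabulate λ {i} i∈ →
        let 1≤ , ≤M = All.lookup (chain-bounds chain)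
              (subst (nth a i ∈_) a≡ (∈-map⁺ (nth a) (∈-resp-↭ u↭ i∈)))
        in ∈-iota⁺ 1 (suc m) 1≤ (s≤s ≤M))

      private
        zz : Zigzag _<_ 1 (suc (length f)) (nth u)
        zz {j} = subst (λ n → Zigzag _<_ 1 (suc n) (nth u)) (sym fibre-length) (proj₂ (Uset⁻ (suc l) u∈)) {j}

        compatible : Compatible f u↭f
        -- Writing `a` as the list of its own entries gives the chain the shape `chain-step`
        -- expects; the discarded first link is the gap before a₁.
        compatible {i} 1≤i i<n with subst (Chain (suc m) (flags l u) 1) (sym a≡) chain
        ... | link _ _ c = subst₂ (λ x y → tally (inRet u i) + x ≤ y)
          (sym (value≡ (∈-iota⁺ 1 (suc l) 1≤i (m<n⇒m<1+n i<1+l))))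
          (sym (value≡ (∈-iota⁺ 1 (suc l) (m≤n⇒m≤1+n 1≤i) (s≤s i<1+l))))
          (chain-step (inRet u) (nth a) 1 l c 1≤i i<1+l)
          where
          i<1+l : i < suc l
          i<1+l = subst (i <_) fibre-length i<n

      fibre-std : std f ≡ u
      fibre-std = compatible⇒std f u↭f (λ {j} → zz {j}) compatible

      fibre-𝒜 : f ∈ 𝒜 (suc l) (suc m)
      fibre-𝒜 = 𝒜⁺ (suc l) (suc m) fibre-length fibre-bounds (compatible⇒alt f u↭f (λ {j} → zz {j}) compatible)

    fibre⁺ : ∀ {f} → f ∈ 𝒜 (suc l) (suc m) → std f ∈ Uset (suc l) × f ∈ fibre l m (std f)
    fibre⁺ {f} f∈ with |f| , f⊆ , zz ← 𝒜⁻ (suc l) (suc m) f∈ =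
      Uset⁺ (suc l) u↭ (subst (λ n → Zigzag _<_ 1 (suc n) (nth u)) |f| (std-alt f (λ {j} → zz {j}))) ,
      subst (_∈ fibre l m u) f≡ (∈-map⁺ (λ a → map (nth a) u) (seqs⁺ (flags l u) 1 m refl chain))
      where
      u = std f
      v : ℕ → ℕ
      v = value f (std-perm f)
      a = map v (iota 1 (suc l))

      u↭ : u ↭ iota 1 (suc l)
      u↭ = subst (λ n → u ↭ iota 1 n) |f| (std-perm f)

      bounds : ∀ {i} → 1 ≤ i → i ≤ suc l → 1 ≤ v i × v i ≤ suc m
      bounds {i} 1≤i i≤ with 1≤j , j≤ ← perm-pos (std-perm f) 1≤i (subst (i ≤_) (sym |f|) i≤)
        with 1≤ , <M ← ∈-iota⁻ 1 (suc m) (All.lookup f⊆ (nth-∈ f (∈-iota⁺ 1 (length f) 1≤j (s≤s j≤)))) = 1≤ , s≤s⁻¹ <M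

      chain : Chain (suc m) (flags l u) 1 a
      chain = link (proj₁ (bounds ≤-refl (s≤s z≤n))) (proj₂ (bounds ≤-refl (s≤s z≤n)))
        (chain⁺ (inRet u) v 1 l
          (λ {i} 1≤i i< → std-compatible f 1≤i (subst (i <_) (sym |f|) i<))
          (λ 1<i i≤ → proj₂ (bounds (<⇒≤ 1<i) i≤)))

      f≡ : map (nth a) u ≡ f
      f≡ = trans (map-≡⁺ λ i∈ → nth-map v (suc l) (∈-resp-↭ u↭ i∈)) (values≡ f (std-perm f))

    -- Both sides are free of repetitions, so equal membership is enough; `std` keeps different
    -- fibres apart.
    𝒜-decomposition : 𝒜 (suc l) (suc m) ↭ concatMap (fibre l m) (Uset (suc l))
    𝒜-decomposition = ∼bag⇒↭ (unique∧set⇒bag (𝒜-unique (suc l) (suc m)) fibres-unique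
      (mk⇔ (λ f∈ → let u∈ , f∈fibre = fibre⁺ f∈ in ∈-concatMap⁺ (fibre l m) (lose u∈ f∈fibre)) from))
      where
      std-fibre : ∀ {u f} → u ∈ Uset (suc l) → f ∈ fibre l m u → std f ≡ u
      std-fibre {u} u∈ f∈ with a , a∈ , refl ← ∈-map⁻ (λ a → map (nth a) u) f∈ = fibre-std u∈ a∈

      fibres-unique : Unique (concatMap (fibre l m) (Uset (suc l)))
      fibres-unique = unique-concatMap (fibre l m) std (Uset-unique (suc l))
        (λ {u} u∈ → unique-map
          (λ a∈ b∈ eq → trans (sym (fibre-recover u∈ a∈))
            (trans (cong (λ f → map (λ i → nth f (pos u i)) (iota 1 (suc l))) eq) (fibre-recover u∈ b∈)))
          (seqs-unique (flags l u) 1 m))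
        std-fibre

      from : ∀ {f} → f ∈ concatMap (fibre l m) (Uset (suc l)) → f ∈ 𝒜 (suc l) (suc m)
      from f∈ with u , u∈ , f∈′ ← find (∈-concatMap⁻ (fibre l m) f∈)
        with a , a∈ , refl ← ∈-map⁻ (λ a → map (nth a) u) f∈′ = fibre-𝒜 u∈ a∈

  -- The value u(1) stands at position 1, which cannot exceed another position by more than 1, so it
  -- is never a return. This supplies `DK`.
  Uset-hd : ∀ l {u} → u ∈ Uset (suc l) → ∃ λ k → hd u ≡ suc k × k ≤ l × inRet u (hd u) ≡ false
  Uset-hd l {[]} u∈ with () ← ↭-length (proj₁ (Uset⁻ (suc l) u∈))
  Uset-hd l {x ∷ xs} u∈ with ∈-iota⁻ 1 (suc l) (∈-resp-↭ (proj₁ (Uset⁻ (suc l) u∈)) (here refl))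
  ... | s≤s {n = k} _ , s≤s (s≤s k≤l) = k , refl , k≤l ,
    cong (λ b → suc (pos (x ∷ xs) (suc x)) <ᵇ (if b then 1 else suc (pos xs x))) (≡ᵇ-refl x)

open Combinatorics using (nth; range1≡iota; length-iota; flags; fibre; 𝒜-decomposition; Uset-hd)

module PowerSeries {c ℓ} (R : CommutativeRing c ℓ) where
  open CommutativeRing R hiding (zero)
  open Series R
  open import Algebra.Properties.Ring ring using (-0#≈0#)
  open SetoidReasoning setoid
  import Algebra.Solver.Ring.NaturalCoefficients.Default as Solver
  open Solver commutativeSemiring using (solve; _:=_; _:+_; _:*_)

  -- The convolution product of power series

  tail : PS → PS
  tail f k = f (suc k)

  scale : Carrier → PS → PS
  scale a f k = a * f k

  sumBelow-cong : ∀ n {g h : PS} → (∀ i → i < n → g i ≈ h i) → sumBelow n g ≈ sumBelow n h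
  sumBelow-cong zero eq = refl
  sumBelow-cong (suc n) eq =
    +-cong (sumBelow-cong n λ i i<n → eq i (ℕ.m<n⇒m<1+n i<n)) (eq n (ℕ.n<1+n n))

  sumBelow-suc : ∀ n (h : PS) → sumBelow (suc n) h ≈ h 0 + sumBelow n (tail h)
  sumBelow-suc zero h = +-comm _ _
  sumBelow-suc (suc n) h = trans (+-congʳ (sumBelow-suc n h)) (+-assoc _ _ _)

  sumBelow-+ : ∀ n (g h : PS) → sumBelow n (g ⊕ h) ≈ sumBelow n g + sumBelow n h
  sumBelow-+ zero g h = sym (+-identityˡ 0#)
  sumBelow-+ (suc n) g h = trans (+-congʳ (sumBelow-+ n g h))
    (solve 4 (λ a b c d → (a :+ b) :+ (c :+ d) := (a :+ c) :+ (b :+ d)) refl _ _ _ _)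

  sumBelow-* : ∀ n a (h : PS) → sumBelow n (scale a h) ≈ a * sumBelow n h
  sumBelow-* zero a h = sym (zeroʳ a)
  sumBelow-* (suc n) a h = trans (+-congʳ (sumBelow-* n a h)) (sym (distribˡ a _ _))

  ⊛-cong : ∀ {f g h k} → f ≈ₛ g → h ≈ₛ k → (f ⊛ h) ≈ₛ (g ⊛ k)
  ⊛-cong p q n = sumBelow-cong (suc n) λ i _ → *-cong (p i) (q (n ∸ i))

  ⊛-zero : ∀ f g → (f ⊛ g) 0 ≈ f 0 * g 0
  ⊛-zero f g = +-identityˡ _

  ⊛-sucˡ : ∀ f g k → (f ⊛ g) (suc k) ≈ f 0 * g (suc k) + (tail f ⊛ g) k
  ⊛-sucˡ f g k = sumBelow-suc (suc k) _

  ⊛-sucʳ : ∀ f g k → (f ⊛ g) (suc k) ≈ f (suc k) * g 0 + (f ⊛ tail g) k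
  ⊛-sucʳ f g k = trans (+-comm _ _) (+-cong
    (*-congˡ (reflexive (≡.cong g (ℕ.n∸n≡0 k))))
    (sumBelow-cong (suc k) λ { i (s≤s i≤k) → *-congˡ (reflexive (≡.cong g (ℕ.+-∸-assoc 1 i≤k))) }))

  -- Peeling the constant term of `f` off on the left of one product and on the right of the other
  -- leaves the same claim for `tail f`, one degree lower.
  ⊛-comm : ∀ f g → (f ⊛ g) ≈ₛ (g ⊛ f)
  ⊛-comm f g zero = +-congˡ (*-comm _ _)
  ⊛-comm f g (suc k) = begin
    (f ⊛ g) (suc k)                  ≈⟨ ⊛-sucˡ f g k ⟩
    f 0 * g (suc k) + (tail f ⊛ g) k ≈⟨ +-cong (*-comm _ _) (⊛-comm (tail f) g k) ⟩
    g (suc k) * f 0 + (g ⊛ tail f) k ≈⟨ ⊛-sucʳ g f k ⟨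
    (g ⊛ f) (suc k)                  ∎

  ⊛-distribʳ : ∀ h f g → ((f ⊕ g) ⊛ h) ≈ₛ ((f ⊛ h) ⊕ (g ⊛ h))
  ⊛-distribʳ h f g k = trans
    (sumBelow-cong (suc k) λ i _ → distribʳ (h (k ∸ i)) (f i) (g i)) (sumBelow-+ (suc k) _ _)

  ⊛-scale : ∀ a f g → (scale a f ⊛ g) ≈ₛ scale a (f ⊛ g)
  ⊛-scale a f g k = trans
    (sumBelow-cong (suc k) λ i _ → *-assoc a (f i) (g (k ∸ i))) (sumBelow-* (suc k) a _)

  -- Induction on the degree: the tail of `f ⊛ g` is f₀ · `tail g` + `tail f ⊛ g`, after which
  -- linearity in the left factor suffices.
  ⊛-assoc : ∀ f g h → ((f ⊛ g) ⊛ h) ≈ₛ (f ⊛ (g ⊛ h))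
  ⊛-assoc f g h zero = begin
    ((f ⊛ g) ⊛ h) 0   ≈⟨ ⊛-zero (f ⊛ g) h ⟩
    (f ⊛ g) 0 * h 0   ≈⟨ *-congʳ (⊛-zero f g) ⟩
    f 0 * g 0 * h 0   ≈⟨ *-assoc _ _ _ ⟩
    f 0 * (g 0 * h 0) ≈⟨ *-congˡ (⊛-zero g h) ⟨
    f 0 * (g ⊛ h) 0   ≈⟨ ⊛-zero f (g ⊛ h) ⟨
    (f ⊛ (g ⊛ h)) 0   ∎
  ⊛-assoc f g h (suc k) = begin
    ((f ⊛ g) ⊛ h) (suc k)
      ≈⟨ ⊛-sucˡ (f ⊛ g) h k ⟩
    (f ⊛ g) 0 * h (suc k) + (tail (f ⊛ g) ⊛ h) k
      ≈⟨ +-cong (*-congʳ (⊛-zero f g)) (⊛-cong {h = h} (⊛-sucˡ f g) (λ _ → refl) k) ⟩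
    f 0 * g 0 * h (suc k) + ((scale (f 0) (tail g) ⊕ (tail f ⊛ g)) ⊛ h) k
      ≈⟨ +-congˡ (⊛-distribʳ h (scale (f 0) (tail g)) (tail f ⊛ g) k) ⟩
    f 0 * g 0 * h (suc k) + ((scale (f 0) (tail g) ⊛ h) k + ((tail f ⊛ g) ⊛ h) k)
      ≈⟨ +-congˡ (+-cong (⊛-scale (f 0) (tail g) h k) (⊛-assoc (tail f) g h k)) ⟩
    f 0 * g 0 * h (suc k) + (f 0 * (tail g ⊛ h) k + (tail f ⊛ (g ⊛ h)) k)
      ≈⟨ solve 5 (λ a b c d e → a :* b :* c :+ (a :* d :+ e) := a :* (b :* c :+ d) :+ e) refl _ _ _ _ _ ⟩
    f 0 * (g 0 * h (suc k) + (tail g ⊛ h) k) + (tail f ⊛ (g ⊛ h)) k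
      ≈⟨ +-congʳ (*-congˡ (⊛-sucˡ g h k)) ⟨
    f 0 * (g ⊛ h) (suc k) + (tail f ⊛ (g ⊛ h)) k
      ≈⟨ ⊛-sucˡ f (g ⊛ h) k ⟨
    (f ⊛ (g ⊛ h)) (suc k) ∎

  cst-⊛ : ∀ a f → (cst a ⊛ f) ≈ₛ scale a f
  cst-⊛ a f zero = ⊛-zero (cst a) f
  cst-⊛ a f (suc k) = begin
    (cst a ⊛ f) (suc k)             ≈⟨ ⊛-sucˡ (cst a) f k ⟩
    -- The zero series is rewritten as 0 times a series so that `⊛-scale` can pull the 0 out of the
    -- product.
    a * f (suc k) + (zeros ⊛ f) k   ≈⟨ +-congˡ (⊛-cong {h = f} (λ _ → sym (zeroˡ 1#)) (λ _ → refl) k) ⟩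
    a * f (suc k) + (scale 0# ones ⊛ f) k ≈⟨ +-congˡ (⊛-scale 0# ones f k) ⟩
    a * f (suc k) + 0# * (ones ⊛ f) k ≈⟨ +-congˡ (zeroˡ _) ⟩
    a * f (suc k) + 0#              ≈⟨ +-identityʳ _ ⟩
    a * f (suc k)                   ∎
    where
    zeros ones : PS
    zeros _ = 0#
    ones _ = 1#

  ⊛-identityˡ : ∀ f → (𝟙 ⊛ f) ≈ₛ f
  ⊛-identityˡ f k = trans (cst-⊛ 1# f k) (*-identityˡ _)

  -- Packaged for the monoid solver, which rearranges the long products below.
  ⊛-commutativeMonoid : CommutativeMonoid c ℓ
  ⊛-commutativeMonoid = record
    { Carrier = PS
    ; _≈_ = _≈ₛ_
    ; _∙_ = _⊛_
    ; ε = 𝟙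
    ; isCommutativeMonoid = record
      { isMonoid = record
        { isSemigroup = record
          { isMagma = record
            { isEquivalence = record
              { refl = λ _ → refl
              ; sym = λ f≈g k → sym (f≈g k)
              ; trans = λ f≈g g≈h k → trans (f≈g k) (g≈h k)
              }
            ; ∙-cong = ⊛-cong
            }
          ; assoc = ⊛-assoc
          }
        ; identity = ⊛-identityˡ , λ f k → trans (⊛-comm f 𝟙 k) (⊛-identityˡ f k)
        }
      ; comm = ⊛-comm
      }
    }

  open CommutativeMonoid ⊛-commutativeMonoid using ()
    renaming (refl to ≈ₛ-refl; sym to ≈ₛ-sym; trans to ≈ₛ-trans; ∙-congˡ to ⊛-congˡ; ∙-congʳ to ⊛-congʳ)

  -- Multiplication by ax and by 1/(1 - ax)

  X-zero : ∀ f → (X ⊛ f) 0 ≈ 0#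
  X-zero f = trans (⊛-zero X f) (zeroˡ _)

  X-suc : ∀ f k → (X ⊛ f) (suc k) ≈ f k
  X-suc f k = begin
    (X ⊛ f) (suc k)                  ≈⟨ ⊛-sucˡ X f k ⟩
    0# * f (suc k) + (tail X ⊛ f) k  ≈⟨ +-cong (zeroˡ _) (⊛-cong {h = f} tail-X (λ _ → refl) k) ⟩
    0# + (𝟙 ⊛ f) k                   ≈⟨ +-identityˡ _ ⟩
    (𝟙 ⊛ f) k                        ≈⟨ ⊛-identityˡ f k ⟩
    f k                              ∎
    where
    tail-X : tail X ≈ₛ 𝟙
    tail-X zero = refl
    tail-X (suc _) = refl

  cstX-zero : ∀ a f → (cst a ⊛ X ⊛ f) 0 ≈ 0#
  cstX-zero a f = begin
    (cst a ⊛ X ⊛ f) 0    ≈⟨ ⊛-assoc (cst a) X f 0 ⟩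
    (cst a ⊛ (X ⊛ f)) 0  ≈⟨ cst-⊛ a (X ⊛ f) 0 ⟩
    a * (X ⊛ f) 0        ≈⟨ *-congˡ (X-zero f) ⟩
    a * 0#               ≈⟨ zeroʳ a ⟩
    0#                   ∎

  cstX-suc : ∀ a f k → (cst a ⊛ X ⊛ f) (suc k) ≈ a * f k
  cstX-suc a f k = begin
    (cst a ⊛ X ⊛ f) (suc k)    ≈⟨ ⊛-assoc (cst a) X f (suc k) ⟩
    (cst a ⊛ (X ⊛ f)) (suc k)  ≈⟨ cst-⊛ a (X ⊛ f) (suc k) ⟩
    a * (X ⊛ f) (suc k)        ≈⟨ *-congˡ (X-suc f k) ⟩
    a * f k                    ∎

  inv1m-zero : ∀ a f → (inv1m a ⊛ f) 0 ≈ f 0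
  inv1m-zero a f = trans (⊛-zero (inv1m a) f) (*-identityˡ _)

  -- The coefficients of h = f + ax·h, where h = f/(1 - ax).
  inv1m-suc : ∀ a f k → (inv1m a ⊛ f) (suc k) ≈ f (suc k) + a * (inv1m a ⊛ f) k
  inv1m-suc a f k = trans (⊛-sucˡ (inv1m a) f k) (+-cong (*-identityˡ _) (⊛-scale a (inv1m a) f k))

  inv1m-inverse : ∀ a → ((𝟙 ⊖ cst a ⊛ X) ⊛ inv1m a) ≈ₛ 𝟙
  inv1m-inverse a k = trans (⊛-comm (𝟙 ⊖ cst a ⊛ X) (inv1m a) k) (go k)
    where
    g : PS
    g = 𝟙 ⊖ cst a ⊛ X

    g₀ : g 0 ≈ 1#
    g₀ = begin
      1# - (cst a ⊛ X) 0 ≈⟨ +-congˡ (-‿cong (trans (cst-⊛ a X 0) (zeroʳ a))) ⟩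
      1# - 0#            ≈⟨ +-congˡ -0#≈0# ⟩
      1# + 0#            ≈⟨ +-identityʳ 1# ⟩
      1#                 ∎

    g₁ : g 1 ≈ - a
    g₁ = trans (+-identityˡ _) (-‿cong (trans (cst-⊛ a X 1) (*-identityʳ a)))

    g₂ : ∀ k → g (suc (suc k)) ≈ 0#
    g₂ k = trans (+-identityˡ _) (trans (-‿cong (trans (cst-⊛ a X (suc (suc k))) (zeroʳ a))) -0#≈0#)

    go : ∀ k → (inv1m a ⊛ g) k ≈ 𝟙 k
    go zero = trans (inv1m-zero a g) g₀
    go (suc zero) = begin
      (inv1m a ⊛ g) 1         ≈⟨ inv1m-suc a g 0 ⟩
      g 1 + a * (inv1m a ⊛ g) 0 ≈⟨ +-cong g₁ (trans (*-congˡ (go 0)) (*-identityʳ a)) ⟩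
      - a + a                 ≈⟨ -‿inverseˡ a ⟩
      0#                      ∎
    go (suc (suc k)) = begin
      (inv1m a ⊛ g) (suc (suc k))               ≈⟨ inv1m-suc a g (suc k) ⟩
      g (suc (suc k)) + a * (inv1m a ⊛ g) (suc k) ≈⟨ +-cong (g₂ k) (trans (*-congˡ (go (suc k))) (zeroʳ a)) ⟩
      0# + 0#                                   ≈⟨ +-identityˡ 0# ⟩
      0#                                        ∎

  open import Algebra.Solver.CommutativeMonoid ⊛-commutativeMonoid as CM using () renaming (_⊕_ to _∙_)

  ^ₛ-distrib-⊛ : ∀ f g k → ((f ⊛ g) ^ₛ k) ≈ₛ ((f ^ₛ k) ⊛ (g ^ₛ k))
  ^ₛ-distrib-⊛ f g zero = ≈ₛ-sym (⊛-identityˡ 𝟙)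
  ^ₛ-distrib-⊛ f g (suc k) = ≈ₛ-trans (⊛-congˡ {f ⊛ g} (^ₛ-distrib-⊛ f g k))
    (CM.solve 4 (λ a b c d → (a ∙ b) ∙ (c ∙ d) CM.⊜ (a ∙ c) ∙ (b ∙ d)) (λ _ → refl) f g (f ^ₛ k) (g ^ₛ k))

  ^ₛ-cong : ∀ {f g} k → f ≈ₛ g → (f ^ₛ k) ≈ₛ (g ^ₛ k)
  ^ₛ-cong zero f≈g = ≈ₛ-refl {𝟙}
  ^ₛ-cong (suc k) f≈g = ⊛-cong f≈g (^ₛ-cong k f≈g)

  𝟙-^ₛ : ∀ k → (𝟙 ^ₛ k) ≈ₛ 𝟙
  𝟙-^ₛ zero = ≈ₛ-refl {𝟙}
  𝟙-^ₛ (suc k) = ≈ₛ-trans (⊛-identityˡ (𝟙 ^ₛ k)) (𝟙-^ₛ k)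

  ^ₛ-+ : ∀ f j k → (f ^ₛ (j ℕ.+ k)) ≈ₛ ((f ^ₛ j) ⊛ (f ^ₛ k))
  ^ₛ-+ f zero k = ≈ₛ-sym (⊛-identityˡ (f ^ₛ k))
  ^ₛ-+ f (suc j) k =
    ≈ₛ-trans (⊛-congˡ {f} (^ₛ-+ f j k)) (≈ₛ-sym (⊛-assoc f (f ^ₛ j) (f ^ₛ k)))

  -- Finite sums over lists

  ∑ : {A : Set} → List A → (A → Carrier) → Carrier
  ∑ xs F = sumL (map F xs)

  module _ {A : Set} where
    ∑-cong : (xs : List A) {F H : A → Carrier} → (∀ {x} → x ∈ xs → F x ≈ H x) → ∑ xs F ≈ ∑ xs H
    ∑-cong [] eq = refl
    ∑-cong (x ∷ xs) eq = +-cong (eq (here ≡.refl)) (∑-cong xs (λ x∈ → eq (there x∈)))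

    ∑-++ : (xs ys : List A) (F : A → Carrier) → ∑ (xs ++ ys) F ≈ ∑ xs F + ∑ ys F
    ∑-++ [] ys F = sym (+-identityˡ _)
    ∑-++ (x ∷ xs) ys F = trans (+-congˡ (∑-++ xs ys F)) (sym (+-assoc _ _ _))

    ∑-*ˡ : (xs : List A) (a : Carrier) (F : A → Carrier) → ∑ xs (λ x → a * F x) ≈ a * ∑ xs F
    ∑-*ˡ [] a F = sym (zeroʳ a)
    ∑-*ˡ (x ∷ xs) a F = trans (+-congˡ (∑-*ˡ xs a F)) (sym (distribˡ a _ _))

    ∑-↭ : {xs ys : List A} (F : A → Carrier) → xs ↭ ys → ∑ xs F ≈ ∑ ys F
    ∑-↭ F ↭.refl = refl
    ∑-↭ F (↭.prep x p) = +-congˡ (∑-↭ F p)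
    ∑-↭ F (↭.swap x y p) = trans (+-congˡ (+-congˡ (∑-↭ F p)))
      (solve 3 (λ a b c → a :+ (b :+ c) := b :+ (a :+ c)) refl _ _ _)
    ∑-↭ F (↭.trans p q) = trans (∑-↭ F p) (∑-↭ F q)

    sumₛ-coeff : (xs : List A) (t : A → PS) → ∀ k → sumₛ (map t xs) k ≈ ∑ xs (λ x → t x k)
    sumₛ-coeff [] t zero = refl
    sumₛ-coeff [] t (suc k) = refl
    sumₛ-coeff (x ∷ xs) t k = +-congˡ (sumₛ-coeff xs t k)

    sumₛ-cong : (xs : List A) {s t : A → PS} → (∀ {x} → x ∈ xs → s x ≈ₛ t x) →
                sumₛ (map s xs) ≈ₛ sumₛ (map t xs)
    sumₛ-cong [] eq k = refl
    sumₛ-cong (x ∷ xs) eq k = +-cong (eq (here ≡.refl) k) (sumₛ-cong xs (λ x∈ → eq (there x∈)) k)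

    ⊛-sumₛ : (f : PS) (xs : List A) (t : A → PS) → (f ⊛ sumₛ (map t xs)) ≈ₛ sumₛ (map (λ x → f ⊛ t x) xs)
    ⊛-sumₛ f [] t k = begin
      (f ⊛ cst 0#) k  ≈⟨ ⊛-comm f (cst 0#) k ⟩
      (cst 0# ⊛ f) k  ≈⟨ cst-⊛ 0# f k ⟩
      0# * f k        ≈⟨ zeroˡ _ ⟩
      0#              ≈⟨ cst0 k ⟨
      cst 0# k        ∎
      where
      cst0 : ∀ k → cst 0# k ≈ 0#
      cst0 zero = refl
      cst0 (suc k) = refl
    ⊛-sumₛ f (x ∷ xs) t k = begin
      (f ⊛ (t x ⊕ sumₛ (map t xs))) k         ≈⟨ ⊛-comm f _ k ⟩
      ((t x ⊕ sumₛ (map t xs)) ⊛ f) k         ≈⟨ ⊛-distribʳ f (t x) (sumₛ (map t xs)) k ⟩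
      (t x ⊛ f) k + (sumₛ (map t xs) ⊛ f) k   ≈⟨ +-cong (⊛-comm (t x) f k) (⊛-comm (sumₛ (map t xs)) f k) ⟩
      (f ⊛ t x) k + (f ⊛ sumₛ (map t xs)) k   ≈⟨ +-congˡ (⊛-sumₛ f xs t k) ⟩
      (f ⊛ t x) k + sumₛ (map (λ x → f ⊛ t x) xs) k ∎

  ∑-map : {A B : Set} (g : A → B) (xs : List A) (F : B → Carrier) → ∑ (map g xs) F ≈ ∑ xs (λ x → F (g x))
  ∑-map g [] F = refl
  ∑-map g (x ∷ xs) F = +-congˡ (∑-map g xs F)

  ∑-concatMap : {A B : Set} (g : A → List B) (xs : List A) (F : B → Carrier) →
                ∑ (concatMap g xs) F ≈ ∑ xs (λ x → ∑ (g x) F)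
  ∑-concatMap g [] F = refl
  ∑-concatMap g (x ∷ xs) F = trans (∑-++ (g x) (concatMap g xs) F) (+-congˡ (∑-concatMap g xs F))

  -- Generating functions of gap sequences

  module _ (p q : Carrier) where

    flag : Carrier → Bool → PS → PS
    flag a true h = cst a ⊛ X ⊛ h
    flag a false h = h

    -- The generating function of seqs ds in which the first k gaps have weight px and the later
    -- ones, including the gap after the last entry, have weight qx.
    gf : ℕ → List Bool → PS
    gf k [] = inv1m q
    gf zero (d ∷ ds) = flag q d (inv1m q ⊛ gf zero ds)
    gf (suc k) (d ∷ ds) = flag p d (inv1m p ⊛ gf k ds)

    count : {A : Set} → List A → Carrier
    count xs = ∑ xs (λ _ → 1#)

    -- Beyond f(1) every unit of room costs q, whichever gap absorbs it, so the weighted sum is q^r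
    -- times a plain count. The two branches of `steps` are the two terms of `inv1m-suc`.
    steps-count : ∀ ds → (∀ c r → pow q r * count (seqs ds c r) ≈ gf 0 ds r) →
                  ∀ c r → pow q r * count (steps ds c r) ≈ (inv1m q ⊛ gf 0 ds) r
    steps-count ds eq c zero = begin
      1# * count (map (c ∷_) (seqs ds c 0)) ≈⟨ *-congˡ (∑-map (c ∷_) (seqs ds c 0) _) ⟩
      1# * count (seqs ds c 0)              ≈⟨ eq c 0 ⟩
      gf 0 ds 0                             ≈⟨ inv1m-zero q (gf 0 ds) ⟨
      (inv1m q ⊛ gf 0 ds) 0                 ∎
    steps-count ds eq c (suc r) = begin
      pow q (suc r) * count (map (c ∷_) (seqs ds c (suc r)) ++ steps ds (suc c) r)
        ≈⟨ *-congˡ (∑-++ (map (c ∷_) (seqs ds c (suc r))) _ _) ⟩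
      pow q (suc r) * (count (map (c ∷_) (seqs ds c (suc r))) + count (steps ds (suc c) r))
        ≈⟨ *-congˡ (+-congʳ (∑-map (c ∷_) (seqs ds c (suc r)) _)) ⟩
      q * pow q r * (count (seqs ds c (suc r)) + count (steps ds (suc c) r))
        ≈⟨ solve 4 (λ a b x y → a :* b :* (x :+ y) := a :* b :* x :+ a :* (b :* y)) refl _ _ _ _ ⟩
      pow q (suc r) * count (seqs ds c (suc r)) + q * (pow q r * count (steps ds (suc c) r))
        ≈⟨ +-cong (eq c (suc r)) (*-congˡ (steps-count ds eq (suc c) r)) ⟩
      gf 0 ds (suc r) + q * (inv1m q ⊛ gf 0 ds) r
        ≈⟨ inv1m-suc q (gf 0 ds) r ⟨
      (inv1m q ⊛ gf 0 ds) (suc r) ∎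

    seqs-count : ∀ ds c r → pow q r * count (seqs ds c r) ≈ gf 0 ds r
    -- The gap after the last entry absorbs all `r` remaining units: the coefficient of x^r in 1/(1
    -- - qx).
    seqs-count [] c r = trans (*-congˡ (+-identityʳ 1#)) (*-identityʳ _)
    seqs-count (false ∷ ds) c r = steps-count ds (seqs-count ds) c r
    seqs-count (true ∷ ds) c zero = trans (zeroʳ _) (sym (cstX-zero q (inv1m q ⊛ gf 0 ds)))
    seqs-count (true ∷ ds) c (suc r) = begin
      q * pow q r * count (steps ds (suc c) r)   ≈⟨ *-assoc _ _ _ ⟩
      q * (pow q r * count (steps ds (suc c) r)) ≈⟨ *-congˡ (steps-count ds (seqs-count ds) (suc c) r) ⟩
      q * (inv1m q ⊛ gf 0 ds) r                  ≈⟨ cstX-suc q (inv1m q ⊛ gf 0 ds) r ⟨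
      gf 0 (true ∷ ds) (suc r)                   ∎

    module _ (M : ℕ) where

      weight : ℕ → Carrier
      weight i = pow p i * pow q (M ℕ.+ 1 ∸ i)

      -- In the invariant, p^c pays for the climb to level `c`; the lone `q` is the excess of the
      -- exponent M + 1 - f(1) over the M - f(1) units above f(1).
      steps-∑ : ∀ ds (F : List ℕ → Carrier) h →
        (∀ c r → c ℕ.+ r ≡ M → ∑ (seqs ds c r) (λ a → F (c ∷ a)) ≈ pow p c * q * h r) →
        ∀ c r → c ℕ.+ r ≡ M → ∑ (steps ds c r) F ≈ pow p c * q * (inv1m p ⊛ h) r
      steps-∑ ds F h eq c zero c+r≡M = begin
        ∑ (map (c ∷_) (seqs ds c 0)) F    ≈⟨ ∑-map (c ∷_) (seqs ds c 0) F ⟩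
        ∑ (seqs ds c 0) (λ a → F (c ∷ a)) ≈⟨ eq c 0 c+r≡M ⟩
        pow p c * q * h 0                 ≈⟨ *-congˡ (inv1m-zero p h) ⟨
        pow p c * q * (inv1m p ⊛ h) 0     ∎
      steps-∑ ds F h eq c (suc r) c+r≡M = begin
        ∑ (map (c ∷_) (seqs ds c (suc r)) ++ steps ds (suc c) r) F
          ≈⟨ ∑-++ (map (c ∷_) (seqs ds c (suc r))) _ F ⟩
        ∑ (map (c ∷_) (seqs ds c (suc r))) F + ∑ (steps ds (suc c) r) F
          ≈⟨ +-cong (trans (∑-map (c ∷_) (seqs ds c (suc r)) F) (eq c (suc r) c+r≡M))
                    (steps-∑ ds F h eq (suc c) r (≡.trans (≡.sym (ℕ.+-suc c r)) c+r≡M)) ⟩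
        pow p c * q * h (suc r) + p * pow p c * q * (inv1m p ⊛ h) r
          ≈⟨ solve 5 (λ a b x y z → a :* b :* x :+ y :* a :* b :* z := a :* b :* (x :+ y :* z)) refl _ _ _ _ _ ⟩
        pow p c * q * (h (suc r) + p * (inv1m p ⊛ h) r)
          ≈⟨ *-congˡ (inv1m-suc p h r) ⟨
        pow p c * q * (inv1m p ⊛ h) (suc r) ∎

      flag-∑ : ∀ d ds (F : List ℕ → Carrier) h →
        (∀ c r → c ℕ.+ r ≡ M → ∑ (steps ds c r) F ≈ pow p c * q * h r) →
        ∀ c r → c ℕ.+ r ≡ M → ∑ (seqs (d ∷ ds) c r) F ≈ pow p c * q * flag p d h r
      flag-∑ false ds F h eq c r c+r≡M = eq c r c+r≡M
      flag-∑ true ds F h eq c zero c+r≡M = sym (trans (*-congˡ (cstX-zero p h)) (zeroʳ _))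
      flag-∑ true ds F h eq c (suc r) c+r≡M = begin
        ∑ (steps ds (suc c) r) F        ≈⟨ eq (suc c) r (≡.trans (≡.sym (ℕ.+-suc c r)) c+r≡M) ⟩
        p * pow p c * q * h r           ≈⟨ solve 4 (λ a b x y → a :* b :* x :* y := b :* x :* (a :* y)) refl _ _ _ _ ⟩
        pow p c * q * (p * h r)         ≈⟨ *-congˡ (cstX-suc p h r) ⟨
        pow p c * q * (cst p ⊛ X ⊛ h) (suc r) ∎

      seqs-∑ : ∀ k ds c r → k < length ds → c ℕ.+ r ≡ M →
        ∑ (seqs ds c r) (λ a → weight (at a k)) ≈ pow p c * q * gf (suc k) ds r
      seqs-∑ zero (d ∷ ds) c r _ = flag-∑ d ds _ _ (steps-∑ ds _ (gf 0 ds) base) c r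
        where
        -- Once the marked entry is fixed as `c` its weight is constant, and M + 1 - c = r + 1
        -- splits into the lone `q` and the q^r of `seqs-count`.
        base : ∀ c r → c ℕ.+ r ≡ M → ∑ (seqs ds c r) (λ _ → weight c) ≈ pow p c * q * gf 0 ds r
        base c r c+r≡M = begin
          ∑ (seqs ds c r) (λ _ → weight c)
            ≈⟨ ∑-cong (seqs ds c r) (λ _ → *-identityʳ _) ⟨
          ∑ (seqs ds c r) (λ _ → weight c * 1#)
            ≈⟨ ∑-*ˡ (seqs ds c r) (weight c) (λ _ → 1#) ⟩
          pow p c * pow q (M ℕ.+ 1 ∸ c) * count (seqs ds c r)
            ≈⟨ *-congʳ (*-congˡ (reflexive (≡.cong (pow q) M+1∸c))) ⟩
          pow p c * (q * pow q r) * count (seqs ds c r)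
            ≈⟨ solve 4 (λ a b x y → a :* (b :* x) :* y := a :* b :* (x :* y)) refl _ _ _ _ ⟩
          pow p c * q * (pow q r * count (seqs ds c r))
            ≈⟨ *-congˡ (seqs-count ds c r) ⟩
          pow p c * q * gf 0 ds r ∎
          where
          M+1∸c : M ℕ.+ 1 ∸ c ≡ suc r
          M+1∸c = ≡.trans (≡.cong (λ z → z ℕ.+ 1 ∸ c) (≡.sym c+r≡M))
            (≡.trans (≡.cong (_∸ c) (ℕ.+-assoc c r 1)) (≡.trans (ℕ.m+n∸m≡n c (r ℕ.+ 1)) (ℕ.+-comm r 1)))
      seqs-∑ (suc k) (d ∷ ds) c r (s≤s k<) =
        flag-∑ d ds _ _ (steps-∑ ds _ (gf (suc k) ds) (λ c r → seqs-∑ k ds c r k<)) c r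

-- Closed forms, and clearing the denominators

module ClosedForm {c ℓ} (R : CommutativeRing c ℓ) (p q : CommutativeRing.Carrier R) where
  open CommutativeRing R using (refl; _*_)
  open Series R
  open PowerSeries R
  open CommutativeMonoid ⊛-commutativeMonoid using ()
    renaming (sym to ≈ₛ-sym; trans to ≈ₛ-trans; setoid to PS-setoid;
              identityʳ to ⊛-identityʳ; ∙-congˡ to ⊛-congˡ; ∙-congʳ to ⊛-congʳ)
  open SetoidReasoning PS-setoid
  open import Algebra.Solver.CommutativeMonoid ⊛-commutativeMonoid as CM using () renaming (_⊕_ to _∙_)

  Px Qx Ip Iq : PS
  Px = cst p ⊛ X
  Qx = cst q ⊛ X
  Ip = inv1m p
  Iq = inv1m q

  flag-^ₛ : ∀ a d h → flag p q a d h ≈ₛ (((cst a ⊛ X) ^ₛ tally d) ⊛ h)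
  flag-^ₛ a true h = ⊛-congʳ {h} (≈ₛ-sym (⊛-identityʳ (cst a ⊛ X)))
  flag-^ₛ a false h = ≈ₛ-sym (⊛-identityˡ h)

  module _ (K : ℕ) (D : ℕ → Bool) (DK : D K ≡ false) where

    gf-late : ∀ o l → K ≤ o →
      gf p q 0 (map D (iota o l)) ≈ₛ ((Qx ^ₛ after K D (iota o l)) ⊛ (Iq ^ₛ suc l))
    gf-late o zero K≤o = ≈ₛ-sym (≈ₛ-trans (⊛-identityˡ _) (⊛-identityʳ Iq))
    gf-late o (suc l) K≤o = begin
      flag p q q (D o) (Iq ⊛ gf p q 0 (map D (iota (suc o) l)))
        ≈⟨ flag-^ₛ q (D o) _ ⟩
      (Qx ^ₛ tally (D o)) ⊛ (Iq ⊛ gf p q 0 (map D (iota (suc o) l)))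
        ≈⟨ ⊛-congˡ {Qx ^ₛ tally (D o)} (⊛-congˡ {Iq} (gf-late (suc o) l (ℕ.m≤n⇒m≤1+n K≤o))) ⟩
      (Qx ^ₛ tally (D o)) ⊛ (Iq ⊛ ((Qx ^ₛ j) ⊛ (Iq ^ₛ suc l)))
        ≈⟨ CM.solve 4 (λ a b c d → a ∙ (b ∙ (c ∙ d)) CM.⊜ (a ∙ c) ∙ (b ∙ d)) (λ _ → refl)
             (Qx ^ₛ tally (D o)) Iq (Qx ^ₛ j) (Iq ^ₛ suc l) ⟩
      (Qx ^ₛ tally (D o)) ⊛ (Qx ^ₛ j) ⊛ (Iq ^ₛ suc (suc l))
        ≈⟨ ⊛-congʳ {Iq ^ₛ suc (suc l)} (^ₛ-+ Qx (tally (D o)) j) ⟨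
      (Qx ^ₛ (tally (D o) ℕ.+ j)) ⊛ (Iq ^ₛ suc (suc l))
        ≡⟨ ≡.cong (λ z → (Qx ^ₛ z) ⊛ (Iq ^ₛ suc (suc l))) (after-late K D DK o _ K≤o) ⟨
      (Qx ^ₛ after K D (iota o (suc l))) ⊛ (Iq ^ₛ suc (suc l)) ∎
      where
      j = after K D (iota (suc o) l)

    -- `k` is the number of gaps from `o` up to, but excluding, index `K`. The remaining l - k gaps
    -- and the closing gap give the exponent of `Iq`. At k = 0 the late case takes over, where `DK`
    -- makes the count of early marks vanish.
    gf-closed : ∀ o k l → K ≡ o ℕ.+ k → k ≤ l →
      gf p q k (map D (iota o l)) ≈ₛ
        ((Px ^ₛ upto K D (iota o l)) ⊛ (Qx ^ₛ after K D (iota o l)) ⊛ (Ip ^ₛ k) ⊛ (Iq ^ₛ suc (l ∸ k)))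
    gf-closed o zero l K≡ _ = begin
      gf p q 0 (map D (iota o l))
        ≈⟨ gf-late o l K≤o ⟩
      (Qx ^ₛ after K D (iota o l)) ⊛ (Iq ^ₛ suc l)
        ≈⟨ CM.solve 2 (λ a b → a ∙ b CM.⊜ ((CM.id ∙ a) ∙ CM.id) ∙ b) (λ _ → refl)
             (Qx ^ₛ after K D (iota o l)) (Iq ^ₛ suc l) ⟩
      𝟙 ⊛ (Qx ^ₛ after K D (iota o l)) ⊛ 𝟙 ⊛ (Iq ^ₛ suc l)
        ≡⟨ ≡.cong (λ z → (Px ^ₛ z) ⊛ (Qx ^ₛ after K D (iota o l)) ⊛ 𝟙 ⊛ (Iq ^ₛ suc l)) (upto-late K D DK o l K≤o) ⟨
      (Px ^ₛ upto K D (iota o l)) ⊛ (Qx ^ₛ after K D (iota o l)) ⊛ 𝟙 ⊛ (Iq ^ₛ suc l) ∎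
      where
      K≤o : K ≤ o
      K≤o = ℕ.≤-reflexive (≡.trans K≡ (ℕ.+-identityʳ o))
    gf-closed o (suc k) (suc l) K≡ (s≤s k≤l) = begin
      flag p q p (D o) (Ip ⊛ gf p q k (map D (iota (suc o) l)))
        ≈⟨ flag-^ₛ p (D o) _ ⟩
      (Px ^ₛ tally (D o)) ⊛ (Ip ⊛ gf p q k (map D (iota (suc o) l)))
        ≈⟨ ⊛-congˡ {Px ^ₛ tally (D o)} (⊛-congˡ {Ip} (gf-closed (suc o) k l (≡.trans K≡ (ℕ.+-suc o k)) k≤l)) ⟩
      (Px ^ₛ tally (D o)) ⊛ (Ip ⊛ ((Px ^ₛ i) ⊛ (Qx ^ₛ j) ⊛ (Ip ^ₛ k) ⊛ (Iq ^ₛ suc (l ∸ k))))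
        ≈⟨ CM.solve 6 (λ a b c d e f → a ∙ (b ∙ (((c ∙ d) ∙ e) ∙ f)) CM.⊜ (((a ∙ c) ∙ d) ∙ (b ∙ e)) ∙ f) (λ _ → refl)
             (Px ^ₛ tally (D o)) Ip (Px ^ₛ i) (Qx ^ₛ j) (Ip ^ₛ k) (Iq ^ₛ suc (l ∸ k)) ⟩
      (Px ^ₛ tally (D o)) ⊛ (Px ^ₛ i) ⊛ (Qx ^ₛ j) ⊛ (Ip ^ₛ suc k) ⊛ (Iq ^ₛ suc (l ∸ k))
        ≈⟨ ⊛-congʳ {Iq ^ₛ suc (l ∸ k)} (⊛-congʳ {Ip ^ₛ suc k} (⊛-congʳ {Qx ^ₛ j} (^ₛ-+ Px (tally (D o)) i))) ⟨
      (Px ^ₛ (tally (D o) ℕ.+ i)) ⊛ (Qx ^ₛ j) ⊛ (Ip ^ₛ suc k) ⊛ (Iq ^ₛ suc (l ∸ k))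
        ≡⟨ ≡.cong₂ (λ y z → (Px ^ₛ y) ⊛ (Qx ^ₛ z) ⊛ (Ip ^ₛ suc k) ⊛ (Iq ^ₛ suc (l ∸ k)))
             (upto-early K D o _ o<K) (after-early K D o _ o<K) ⟨
      (Px ^ₛ upto K D (iota o (suc l))) ⊛ (Qx ^ₛ after K D (iota o (suc l))) ⊛ (Ip ^ₛ suc k) ⊛ (Iq ^ₛ suc (l ∸ k)) ∎
      where
      i = upto K D (iota (suc o) l)
      j = after K D (iota (suc o) l)
      o<K : o < K
      o<K = ≡.subst (o <_) (≡.sym (≡.trans K≡ (ℕ.+-suc o k))) (s≤s (ℕ.m≤m+n o k))

  -- The numerator (1 - qx)^k cancels k of the N factors 1/(1 - qx); `k ≤ N` makes `N ∸ k` a true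
  -- difference.
  clear-denominators : ∀ C A B {k N} → k ≤ N →
    (C ⊛ A ⊛ B ⊛ (Ip ^ₛ k) ⊛ (Iq ^ₛ (N ∸ k))) ≈ₛ
    (C ⊛ (A ⊛ B ⊛ (((𝟙 ⊖ Qx) ⊛ Ip) ^ₛ k)) ⊛ (Iq ^ₛ N))
  clear-denominators C A B {k} {N} k≤N = ≈ₛ-sym (begin
    C ⊛ (A ⊛ B ⊛ ((Y ⊛ Ip) ^ₛ k)) ⊛ (Iq ^ₛ N)
      ≡⟨ ≡.cong (λ z → C ⊛ (A ⊛ B ⊛ ((Y ⊛ Ip) ^ₛ k)) ⊛ (Iq ^ₛ z)) (ℕ.m+[n∸m]≡n k≤N) ⟨
    C ⊛ (A ⊛ B ⊛ ((Y ⊛ Ip) ^ₛ k)) ⊛ (Iq ^ₛ (k ℕ.+ (N ∸ k)))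
      ≈⟨ ⊛-cong (⊛-congˡ {C} (⊛-congˡ {A ⊛ B} (^ₛ-distrib-⊛ Y Ip k))) (^ₛ-+ Iq k (N ∸ k)) ⟩
    C ⊛ (A ⊛ B ⊛ ((Y ^ₛ k) ⊛ (Ip ^ₛ k))) ⊛ ((Iq ^ₛ k) ⊛ (Iq ^ₛ (N ∸ k)))
      ≈⟨ CM.solve 7 (λ a b c d e f g → (a ∙ ((b ∙ c) ∙ (d ∙ e))) ∙ (f ∙ g) CM.⊜ (d ∙ f) ∙ ((((a ∙ b) ∙ c) ∙ e) ∙ g))
           (λ _ → refl)
           C A B (Y ^ₛ k) (Ip ^ₛ k) (Iq ^ₛ k) (Iq ^ₛ (N ∸ k)) ⟩
    ((Y ^ₛ k) ⊛ (Iq ^ₛ k)) ⊛ (C ⊛ A ⊛ B ⊛ (Ip ^ₛ k) ⊛ (Iq ^ₛ (N ∸ k)))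
      ≈⟨ ⊛-congʳ {C ⊛ A ⊛ B ⊛ (Ip ^ₛ k) ⊛ (Iq ^ₛ (N ∸ k))} (^ₛ-distrib-⊛ Y Iq k) ⟨
    ((Y ⊛ Iq) ^ₛ k) ⊛ (C ⊛ A ⊛ B ⊛ (Ip ^ₛ k) ⊛ (Iq ^ₛ (N ∸ k)))
      ≈⟨ ⊛-congʳ {C ⊛ A ⊛ B ⊛ (Ip ^ₛ k) ⊛ (Iq ^ₛ (N ∸ k))} (≈ₛ-trans (^ₛ-cong k (inv1m-inverse q)) (𝟙-^ₛ k)) ⟩
    𝟙 ⊛ (C ⊛ A ⊛ B ⊛ (Ip ^ₛ k) ⊛ (Iq ^ₛ (N ∸ k)))
      ≈⟨ ⊛-identityˡ _ ⟩
    C ⊛ A ⊛ B ⊛ (Ip ^ₛ k) ⊛ (Iq ^ₛ (N ∸ k)) ∎)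
    where
    Y : PS
    Y = 𝟙 ⊖ Qx

  middle≈rhs : ∀ n → (∀ {u} → u ∈ Uset n → hd u ≤ n ℕ.+ 1) → middle n p q ≈ₛ rhs n p q
  middle≈rhs n hd≤ = begin
    middle n p q
      ≈⟨ sumₛ-cong (Uset n) (λ {u} u∈ → ≈ₛ-trans (clear-denominators C (A u) (B u) (hd≤ u∈))
           (⊛-comm _ (Iq ^ₛ (n ℕ.+ 1)))) ⟩
    sumₛ (map (λ u → (Iq ^ₛ (n ℕ.+ 1)) ⊛ (C ⊛ t u)) (Uset n))
      ≈⟨ ⊛-sumₛ (Iq ^ₛ (n ℕ.+ 1)) (Uset n) (λ u → C ⊛ t u) ⟨
    (Iq ^ₛ (n ℕ.+ 1)) ⊛ sumₛ (map (λ u → C ⊛ t u) (Uset n))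
      ≈⟨ ⊛-congˡ {Iq ^ₛ (n ℕ.+ 1)} (⊛-sumₛ C (Uset n) t) ⟨
    (Iq ^ₛ (n ℕ.+ 1)) ⊛ (C ⊛ UnAt n p q)
      ≈⟨ ⊛-comm (Iq ^ₛ (n ℕ.+ 1)) (C ⊛ UnAt n p q) ⟩
    rhs n p q ∎
    where
    C : PS
    C = cst (p * q) ⊛ X
    A B t : List ℕ → PS
    A u = Px ^ₛ retMinus n u
    B u = Qx ^ₛ retPlus n u
    t u = A u ⊛ B u ⊛ (((𝟙 ⊖ Qx) ⊛ Ip) ^ₛ hd u)

-- Comparing coefficients

module Enumeration {c ℓ} (R : CommutativeRing c ℓ) (p q : CommutativeRing.Carrier R) where
  open CommutativeRing R using (Carrier; _≈_; _*_; 0#; 1#; *-congʳ; *-identityʳ; zeroˡ)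
    renaming (refl to ≈-refl; sym to ≈-sym; trans to ≈-trans; setoid to R-setoid)
  open Series R
  open PowerSeries R
  open ClosedForm R p q
  open CommutativeMonoid ⊛-commutativeMonoid using ()
    renaming (setoid to PS-setoid; ∙-congˡ to ⊛-congˡ)
  open import Algebra.Solver.CommutativeMonoid ⊛-commutativeMonoid as CM using () renaming (_⊕_ to _∙_)

  term : ℕ → List ℕ → PS
  term n u = cst (p * q) ⊛ X ⊛ (Px ^ₛ retMinus n u) ⊛ (Qx ^ₛ retPlus n u) ⊛ (Ip ^ₛ hd u) ⊛ (Iq ^ₛ (n ℕ.+ 1 ∸ hd u))

  term≈gf : ∀ l {u} → u ∈ Uset (suc l) → term (suc l) u ≈ₛ (cst (p * q) ⊛ X ⊛ gf p q (hd u) (flags l u))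
  term≈gf l {u} u∈ with k , hd≡ , k≤l , DK ← Uset-hd l u∈ rewrite hd≡ | range1≡iota l = begin
    C ⊛ A ⊛ B ⊛ (Ip ⊛ (Ip ^ₛ k)) ⊛ (Iq ^ₛ (l ℕ.+ 1 ∸ k))
      ≡⟨ ≡.cong (λ z → C ⊛ A ⊛ B ⊛ (Ip ⊛ (Ip ^ₛ k)) ⊛ (Iq ^ₛ z))
           (≡.trans (≡.cong (_∸ k) (ℕ.+-comm l 1)) (ℕ.+-∸-assoc 1 k≤l)) ⟩
    C ⊛ A ⊛ B ⊛ (Ip ⊛ (Ip ^ₛ k)) ⊛ (Iq ^ₛ suc (l ∸ k))
      ≈⟨ CM.solve 6 (λ a b c d e f → (((a ∙ b) ∙ c) ∙ (d ∙ e)) ∙ f CM.⊜ a ∙ (d ∙ (((b ∙ c) ∙ e) ∙ f))) (λ _ → ≈-refl)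
           C A B Ip (Ip ^ₛ k) (Iq ^ₛ suc (l ∸ k)) ⟩
    -- The isolated `Ip` is the free gap before a₁; the closed form covers the gaps from index 1 on.
    C ⊛ (Ip ⊛ (A ⊛ B ⊛ (Ip ^ₛ k) ⊛ (Iq ^ₛ suc (l ∸ k))))
      ≈⟨ ⊛-congˡ {C} (⊛-congˡ {Ip} (gf-closed (suc k) (inRet u) DK 1 k l ≡.refl k≤l)) ⟨
    C ⊛ (Ip ⊛ gf p q k (map (inRet u) (iota 1 l))) ∎
    where
    open SetoidReasoning PS-setoid
    C A B : PS
    C = cst (p * q) ⊛ X
    A = Px ^ₛ upto (suc k) (inRet u) (iota 1 l)
    B = Qx ^ₛ after (suc k) (inRet u) (iota 1 l)

  fibre-∑ : ∀ l m {u} → u ∈ Uset (suc l) →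
    ∑ (fibre l m u) (λ f → weight p q (suc m) (hd f)) ≈ (p * q) * gf p q (hd u) (flags l u) m
  fibre-∑ l m {[]} u∈ with () ← Uset-hd l u∈
  fibre-∑ l m {x ∷ xs} u∈ with k , ≡.refl , k≤l , _ ← Uset-hd l u∈ = begin
    ∑ (fibre l m u) (λ f → weight p q (suc m) (hd f))
      ≈⟨ ∑-map (λ a → map (nth a) u) (seqs (flags l u) 1 m) _ ⟩
    -- f(1) is the entry of `a` with index u(1) = `suc k`, hence with zero-based index `k`.
    ∑ (seqs (flags l u) 1 m) (λ a → weight p q (suc m) (at a k))
      ≈⟨ seqs-∑ p q (suc m) k (flags l u) 1 m k< ≡.refl ⟩
    (p * 1#) * q * gf p q (suc k) (flags l u) m
      ≈⟨ *-congʳ (*-congʳ (*-identityʳ p)) ⟩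
    (p * q) * gf p q (suc k) (flags l u) m ∎
    where
    open SetoidReasoning R-setoid
    u = x ∷ xs
    k< : k < length (flags l u)
    k< = ≡.subst (λ n → k < suc n) (≡.sym (≡.trans (length-map (inRet u) (iota 1 l)) (length-iota 1 l))) (s≤s k≤l)

  -- The prefactor pqx shifts degrees by one, so coefficient m + 1 meets the fibre sums with `m`
  -- units of room, and both sides vanish in degree 0.
  G≈middle : ∀ l → G (suc l) p q ≈ₛ middle (suc l) p q
  G≈middle l zero = ≈-sym (begin
    middle (suc l) p q 0                    ≈⟨ sumₛ-coeff U (term (suc l)) 0 ⟩
    ∑ U (λ u → term (suc l) u 0)
      ≈⟨ ∑-cong U (λ {u} u∈ → ≈-trans (term≈gf l u∈ 0)
           (≈-trans (cstX-zero (p * q) (gf p q (hd u) (flags l u))) (≈-sym (zeroˡ 0#)))) ⟩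
    -- Zero is written as a product so that `∑-*ˡ` can take a factor 0 out of the sum.
    ∑ U (λ _ → 0# * 0#)                     ≈⟨ ∑-*ˡ U 0# (λ _ → 0#) ⟩
    0# * ∑ U (λ _ → 0#)                     ≈⟨ zeroˡ _ ⟩
    0#                                      ∎)
    where
    open SetoidReasoning R-setoid
    U = Uset (suc l)
  G≈middle l (suc m) = begin
    ∑ (𝒜 (suc l) (suc m)) w                 ≈⟨ ∑-↭ w (𝒜-decomposition l m) ⟩
    ∑ (concatMap (fibre l m) U) w           ≈⟨ ∑-concatMap (fibre l m) U w ⟩
    ∑ U (λ u → ∑ (fibre l m u) w)
      ≈⟨ ∑-cong U (λ {u} u∈ → ≈-trans (fibre-∑ l m u∈)
           (≈-sym (≈-trans (term≈gf l u∈ (suc m)) (cstX-suc (p * q) (gf p q (hd u) (flags l u)) m)))) ⟩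
    ∑ U (λ u → term (suc l) u (suc m))      ≈⟨ sumₛ-coeff U (term (suc l)) (suc m) ⟨
    middle (suc l) p q (suc m)              ∎
    where
    open SetoidReasoning R-setoid
    U = Uset (suc l)
    w : List ℕ → Carrier
    w f = weight p q (suc m) (hd f)

theorem4p2 : ∀ {c ℓ} (R : CommutativeRing c ℓ) (p q : CommutativeRing.Carrier R) (n : ℕ) → 1 ≤ n →
    let open Series R in
    (G n p q ≈ₛ middle n p q) × (middle n p q ≈ₛ rhs n p q)
theorem4p2 R p q (suc l) _ = Enumeration.G≈middle R p q l , ClosedForm.middle≈rhs R p q (suc l) hd≤
  where
  hd≤ : ∀ {u} → u ∈ Uset (suc l) → hd u ≤ suc l ℕ.+ 1
  hd≤ u∈ with k , hd≡ , k≤l , _ ← Uset-hd l u∈ =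
    ≡.subst (_≤ suc l ℕ.+ 1) (≡.sym hd≡) (ℕ.≤-trans (s≤s k≤l) (ℕ.m≤m+n (suc l) 1))
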